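{- Let $n\ge 1$ be an integer and let $\Phi_n(x)$ denote the $n$-th cyclotomic polynomial. Then for every $j=1,\dots,\phi(n)$ we have $\Phi_n^{(j)}(1)>0$. Consequently, for every $k=0,1,\dots,\phi(n)-1$, the function $x\mapsto \Phi_n^{(k)}(x)$ is strictly increasing on $[1,\infty)$.
   Context: $\Phi_n(x)=\prod_{0<d\le n,\ (d,n)=1}\bigl(x-e^{2\pi i d/n}\bigr)\in\mathbb{Z}[x]$ is the $n$-th cyclotomic polynomial, of degree $\phi(n)$ where $\phi$ is Euler's totient function; $\Phi_n^{(j)}$ denotes its $j$-th derivative.
   Formalization: Strict increase of the k-th derivative of the cyclotomic polynomial on [1,∞) is stated and proved for rational points 1 ≤ x < y only; the real case follows by density and continuity. -}

module Defs where

open import Data.Nat as ℕ using (ℕ; zero; suc; _∸_)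
open import Data.Nat.Divisibility using (_∣?_)
open import Data.Nat.Coprimality using (coprime?)
open import Data.Integer as ℤ using (ℤ; +_)
open import Data.Rational as ℚ using (ℚ)
open import Data.List using (List; []; _∷_; map; reverse; foldr; length; filter; upTo; replicate; _++_)

-- Polynomials with integer coefficients, as little-endian coefficient lists:
-- the list a₀ ∷ a₁ ∷ … ∷ a_d represents a₀ + a₁ x + … + a_d x^d.
Poly : Set
Poly = List ℤ

padd : Poly → Poly → Poly
padd [] q = q
padd p [] = p
padd (a ∷ p) (b ∷ q) = (a ℤ.+ b) ∷ padd p q

psub : List ℤ → List ℤ → List ℤ
psub [] q = map ℤ.-_ q
psub p [] = p
psub (a ∷ p) (b ∷ q) = (a ℤ.- b) ∷ psub p q

pmul : Poly → Poly → Poly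
pmul [] q = []
pmul (a ∷ p) q = padd (map (a ℤ.*_) q) (+ 0 ∷ pmul p q)

pprod : List Poly → Poly
pprod = foldr pmul (+ 1 ∷ [])

-- long division by a monic divisor, on big-endian lists.
-- divBE k a (1 ∷ bs) computes the first k quotient coefficients (big-endian).
divBE : ℕ → List ℤ → List ℤ → List ℤ
divBE zero a b = []
divBE (suc k) [] b = []
divBE (suc k) (c ∷ as) [] = []
divBE (suc k) (c ∷ as) (b ∷ bs) = c ∷ divBE k (psub as (map (c ℤ.*_) bs)) (b ∷ bs)

-- quotient of p by a monic q (exact polynomial division when q ∣ p)
pdiv : Poly → Poly → Poly
pdiv p q = reverse (divBE (suc (length p ∸ length q)) (reverse p) (reverse q))

xnm1 : ℕ → Poly
xnm1 zero = []
xnm1 (suc m) = ℤ.-[1+ 0 ] ∷ replicate m (+ 0) ++ (+ 1 ∷ [])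

properDivisors : ℕ → List ℕ
properDivisors n = filter (λ d → d ∣? n) (map suc (upTo (n ∸ 1)))

-- Cyclotomic polynomials via the standard recursion
--   Φ_n(x) = (x^n - 1) / ∏_{d ∣ n, d < n} Φ_d(x),
-- implemented with a fuel argument (fuel n suffices, since d < n).
cycloF : ℕ → ℕ → Poly
cycloF zero n = []
cycloF (suc f) n = pdiv (xnm1 n) (pprod (map (cycloF f) (properDivisors n)))

Φ : ℕ → Poly
Φ n = cycloF n n

derivAux : ℕ → Poly → Poly
derivAux i [] = []
derivAux i (a ∷ p) = (+ i ℤ.* a) ∷ derivAux (suc i) p

deriv : Poly → Poly
deriv [] = []
deriv (a ∷ p) = derivAux 1 p

derivN : ℕ → Poly → Poly
derivN zero p = p
derivN (suc j) p = derivN j (deriv p)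

evalℤ : Poly → ℤ → ℤ
evalℤ [] x = + 0
evalℤ (a ∷ p) x = a ℤ.+ x ℤ.* evalℤ p x

evalℚ : Poly → ℚ → ℚ
evalℚ [] x = ℚ.0ℚ
evalℚ (a ∷ p) x = (a ℚ./ 1) ℚ.+ x ℚ.* evalℚ p x

φ : ℕ → ℕ
φ n = length (filter (λ d → coprime? d n) (map suc (upTo n)))

{-# OPTIONS --safe #-}
module Submission where

-- Every monic f ∈ ℤ[x] dividing xⁿ - 1 has positive Taylor coefficients of orders 1, …, deg f at 1.
-- Write f h = xⁿ - 1 and let c be the cyclic autocorrelation of h.
-- The Toeplitz form of c is positive definite on polynomials of degree < deg f, and f generates
-- its kernel.  Hence f is, up to a factor, the last term of the Szegő recursion of c,
--   φ⁺ = b x φ - a ψ,   ψ⁺ = b ψ - a x φ    (ψ the reversal of φ),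
-- where b > ∣a∣ except at the last step, where b = ∣a∣.  Expanded in y = x - 1, the recursion reads
--   φ⁺ ± ψ⁺ = (b ∓ a) (φ ± ψ + y φ),
-- so that nonnegativity of the coefficients propagates.
--
-- That Φ n has degree φ n and divides xⁿ - 1 follows from Φ d and Φ e (d ≠ e) generating an ideal
-- of ℤ[x] that contains a positive integer, together with Gauss' sum of φ over the divisors of n.

open import Defs
open import Data.Nat as ℕ using (ℕ; zero; suc; z≤n; s≤s)
import Data.Nat.Properties as ℕ
open import Data.Nat.Coprimality using (Coprime; coprime?; coprime⇒gcd≡1; gcd≡1⇒coprime)
open import Data.Nat.Divisibility as ℕ using (_∣_; _∣?_; divides)
open import Data.Nat.GCD using (gcd; gcd[m,n]∣m; gcd[m,n]∣n; gcd[m,n]≢0; gcd-GCD; c*gcd[m,n]≡gcd[cm,cn]; module Bézout)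
open import Data.Nat.Induction using (<-rec)
open import Data.Nat.ListAction using (sum)
open import Data.Nat.ListAction.Properties using (sum-++)
open import Data.Nat.Tactic.RingSolver using () renaming (solve-∀ to solveℕ-∀)
open import Data.Integer as ℤ using (ℤ; +_; -[1+_]; _+_; _*_; -_; _-_; _^_; _≤_; _<_; ∣_∣; +≤+; +<+)
import Data.Integer.Properties as ℤ
open import Data.Integer.Divisibility.Signed using (∣⇒∣ᵤ; ∣ᵤ⇒∣; ∣m∣n⇒∣m+n; ∣m+n∣m⇒∣n; ∣-refl) renaming (_∣_ to _∣ᶻ_)
open import Data.Integer.Tactic.RingSolver using (solve-∀)
open import Data.Rational as ℚ using (ℚ; 0ℚ; 1ℚ)
import Data.Rational.Properties as ℚ
import Data.Rational.Unnormalised as ℚᵘ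
import Data.Rational.Unnormalised.Properties as ℚᵘ
open import Data.List using (List; []; _∷_; map; reverse; length; replicate; _++_; filter; upTo)
import Data.List.Properties as List
open import Data.List.Relation.Unary.All as All using (All; []; _∷_)
import Data.List.Relation.Unary.All.Properties as All
open import Data.Product using (∃; _×_; _,_; proj₁; proj₂)
open import Data.Sum using (_⊎_; inj₁; inj₂)
open import Data.Empty using (⊥-elim)
open import Algebra.Properties.AbelianGroup ℤ.+-0-abelianGroup using (∙-cancelʳ)
open import Relation.Nullary using (¬_; Dec; yes; no)
open import Relation.Binary.PropositionalEquality using (_≡_; _≢_; refl; sym; trans; cong; cong₂; subst; subst₂; module ≡-Reasoning)

-- Polynomials through their values

-- By Parseval, n c(i) is the sum of |h(ζ)|² ζ^i over the n-th roots of unity ζ. Thus c is the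
-- moment sequence of a positive measure carried exactly by the roots of f, which is why the form
-- has rank deg f and why the recursion breaks off at f. Working with c itself keeps complex roots
-- out of the proof. The usual reflection coefficient a / b is cleared of its denominator, so φ and
-- ψ stay in ℤ[x]; integrality then sharpens b > |a| to b - |a| ≥ 1. The result starts at order 1
-- because strict positivity comes only from the term y φ, which is absent at order 0. Since Φ n is
-- the output of a long division, that division must be shown exact. Two cyclotomic polynomials need
-- not generate 1 (x - 1 and x + 1 generate only 2 among the constants, up to multiples), so
-- divisibility is first known only for an integer multiple of xⁿ - 1. Growth at large integers then
-- forces the remainder to vanish, which removes the multiple without Gauss' lemma on contents.

scale : ℤ → Poly → Poly
scale c = map (c *_)

eval-padd : ∀ p q x → evalℤ (padd p q) x ≡ evalℤ p x + evalℤ q x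
eval-padd [] q x = sym (ℤ.+-identityˡ _)
eval-padd (a ∷ p) [] x = sym (ℤ.+-identityʳ _)
eval-padd (a ∷ p) (b ∷ q) x rewrite eval-padd p q x = lem a b x (evalℤ p x) (evalℤ q x)
  where
  lem : ∀ a b x u v → a + b + x * (u + v) ≡ a + x * u + (b + x * v)
  lem = solve-∀

eval-scale : ∀ c p x → evalℤ (scale c p) x ≡ c * evalℤ p x
eval-scale c [] x = sym (ℤ.*-zeroʳ c)
eval-scale c (a ∷ p) x rewrite eval-scale c p x = lem c a x (evalℤ p x)
  where
  lem : ∀ c a x u → c * a + x * (c * u) ≡ c * (a + x * u)
  lem = solve-∀

eval-pmul : ∀ p q x → evalℤ (pmul p q) x ≡ evalℤ p x * evalℤ q x
eval-pmul [] q x = refl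
eval-pmul (a ∷ p) q x
  rewrite eval-padd (scale a q) (+ 0 ∷ pmul p q) x | eval-scale a q x | eval-pmul p q x
  = lem a x (evalℤ p x) (evalℤ q x)
  where
  lem : ∀ a x u v → a * v + (+ 0 + x * (u * v)) ≡ (a + x * u) * v
  lem = solve-∀

eval-++ : ∀ p q x → evalℤ (p ++ q) x ≡ evalℤ p x + x ^ length p * evalℤ q x
eval-++ [] q x = lem (evalℤ q x)
  where
  lem : ∀ u → u ≡ + 0 + + 1 * u
  lem = solve-∀
eval-++ (a ∷ p) q x rewrite eval-++ p q x = lem a x (evalℤ p x) (x ^ length p) (evalℤ q x)
  where
  lem : ∀ a x u y v → a + x * (u + y * v) ≡ a + x * u + x * y * v
  lem = solve-∀

IsZero : Poly → Set
IsZero = All (_≡ + 0)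

eval-zero : ∀ {p} → IsZero p → ∀ x → evalℤ p x ≡ + 0
eval-zero [] x = refl
eval-zero (refl ∷ z) x rewrite eval-zero z x = trans (ℤ.+-identityˡ _) (ℤ.*-zeroʳ x)

private
  large-multiple : ∀ a m e → ∣ a ∣ ℕ.< m → a + + m * e ≡ + 0 → e ≡ + 0
  large-multiple a m e a<m eq = by-size ∣ e ∣ refl
    where
    open ℕ.≤-Reasoning
    lem : ∀ a b → a ≡ a + b - b
    lem = solve-∀
    a≡ : a ≡ - (+ m * e)
    a≡ = trans (lem a (+ m * e)) (trans (cong (_- + m * e) eq) (ℤ.+-identityˡ _))
    by-size : ∀ k → ∣ e ∣ ≡ k → e ≡ + 0
    by-size zero    eq′ = ℤ.∣i∣≡0⇒i≡0 eq′
    by-size (suc k) eq′ = ⊥-elim (ℕ.<⇒≱ a<m (begin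
      m                 ≤⟨ ℕ.m≤m*n m (suc k) ⟩
      m ℕ.* suc k       ≡⟨ cong (m ℕ.*_) (sym eq′) ⟩
      m ℕ.* ∣ e ∣       ≡⟨ sym (ℤ.∣i*j∣≡∣i∣*∣j∣ (+ m) e) ⟩
      ∣ + m * e ∣       ≡⟨ sym (ℤ.∣-i∣≡∣i∣ (+ m * e)) ⟩
      ∣ - (+ m * e) ∣   ≡⟨ cong ∣_∣ (sym a≡) ⟩
      ∣ a ∣             ∎))

-- At a point m beyond |a|, a + m e = 0 forces e = 0 and hence a = 0; the tail then vanishes at
-- every later positive point. This is the passage from values back to coefficients; zero is
-- all-zero entries because lists may carry padding.
eventually-zero : ∀ p B → (∀ m → B ℕ.≤ m → evalℤ p (+ m) ≡ + 0) → IsZero p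
eventually-zero [] B h = []
eventually-zero (a ∷ p) B h = a≡0 ∷ eventually-zero p (suc B) h′
  where
  m₀ : ℕ
  m₀ = suc (∣ a ∣ ℕ.+ B)
  e≡0 : evalℤ p (+ m₀) ≡ + 0
  e≡0 = large-multiple a m₀ _ (s≤s (ℕ.m≤m+n _ _)) (h m₀ (ℕ.m≤n⇒m≤1+n (ℕ.m≤n+m B ∣ a ∣)))
  a≡0 : a ≡ + 0
  a≡0 = begin
    a                            ≡⟨ sym (ℤ.+-identityʳ a) ⟩
    a + + 0                      ≡⟨ cong (_+_ a) (sym (trans (cong (+ m₀ *_) e≡0) (ℤ.*-zeroʳ (+ m₀)))) ⟩
    a + + m₀ * evalℤ p (+ m₀)    ≡⟨ h m₀ (ℕ.m≤n⇒m≤1+n (ℕ.m≤n+m B ∣ a ∣)) ⟩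
    + 0                          ∎
    where open ≡-Reasoning
  h′ : ∀ m → suc B ℕ.≤ m → evalℤ p (+ m) ≡ + 0
  h′ m B<m = large-multiple (+ 0) m _ (ℕ.≤-trans (s≤s z≤n) B<m)
    (trans (cong (_+ + m * evalℤ p (+ m)) (sym a≡0)) (h m (ℕ.≤-trans (ℕ.n≤1+n B) B<m)))

-- Leading coefficients and cancellation of monic factors

infix 4 _≈_
_≈_ : Poly → Poly → Set
p ≈ q = ∀ x → evalℤ p x ≡ evalℤ q x

-- The list has exactly k + 1 entries, with no padding after ℓ, since `pdiv` reads degrees off
-- `length`. A general ℓ is allowed because the orthogonal polynomials below are not normalised.
data Leading (ℓ : ℤ) : ℕ → Poly → Set where
  top  : Leading ℓ 0 (ℓ ∷ [])
  cons : ∀ {k p} a → Leading ℓ k p → Leading ℓ (suc k) (a ∷ p)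

Monic : ℕ → Poly → Set
Monic = Leading (+ 1)

leading-length : ∀ {ℓ k p} → Leading ℓ k p → length p ≡ suc k
leading-length top = refl
leading-length (cons a m) = cong suc (leading-length m)

leading-scale : ∀ {ℓ k p} c → Leading ℓ k p → Leading (c * ℓ) k (scale c p)
leading-scale c top = top
leading-scale c (cons a m) = cons (c * a) (leading-scale c m)

leading-paddˡ : ∀ {ℓ k q} p → length p ℕ.≤ k → Leading ℓ k q → Leading ℓ k (padd p q)
leading-paddˡ [] _ m = m
leading-paddˡ (a ∷ p) (s≤s l) (cons b m) = cons (a + b) (leading-paddˡ p l m)

monic-∷ʳ : ∀ p → Monic (length p) (p ++ + 1 ∷ [])
monic-∷ʳ [] = top
monic-∷ʳ (a ∷ p) = cons a (monic-∷ʳ p)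

monic-∷ʳ⁻¹ : ∀ {k p} → Monic k p → ∃ λ q → p ≡ q ++ + 1 ∷ [] × length q ≡ k
monic-∷ʳ⁻¹ top = [] , refl , refl
monic-∷ʳ⁻¹ (cons a m) with monic-∷ʳ⁻¹ m
... | q , refl , refl = a ∷ q , refl , refl

monic-pmul : ∀ {j k p q} → Monic j p → Monic k q → Monic (j ℕ.+ k) (pmul p q)
monic-pmul top m = unit m
  where
  padd-[] : ∀ p → padd p [] ≡ p
  padd-[] [] = refl
  padd-[] (_ ∷ _) = refl
  unit : ∀ {k q} → Monic k q → Monic k (padd (scale (+ 1) q) (+ 0 ∷ []))
  unit top = top
  unit (cons a m) = cons _ (subst (Monic _) (sym (padd-[] _)) (leading-scale (+ 1) m))
monic-pmul {suc j} {k} {a ∷ p} {q} (cons a m) m′ = leading-paddˡ (scale a q) l (cons (+ 0) (monic-pmul m m′))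
  where
  l : length (scale a q) ℕ.≤ suc (j ℕ.+ k)
  l rewrite List.length-map (a *_) q | leading-length m′ = s≤s (ℕ.m≤n+m k j)

Eventually : (ℤ → Set) → Set
Eventually P = ∃ λ B → ∀ m → B ℕ.≤ m → P (+ m)

-- Once the tail is at least 1 and m exceeds |a|, the value is at least a + m ≥ 1. This replaces
-- degree arguments: a monic factor can be cancelled at all large integers.
monic-positive : ∀ {k p} → Monic k p → Eventually (λ x → + 1 ≤ evalℤ p x)
monic-positive top = 0 , λ m _ → ℤ.≤-reflexive (sym (trans (cong (_+_ (+ 1)) (ℤ.*-zeroʳ (+ m))) refl))
monic-positive (cons {p = p} a mp) with monic-positive mp
... | B , h = suc ∣ a ∣ ℕ.+ B , λ m le → begin
      + 1                      ≤⟨ ≤a (ℕ.≤-trans (ℕ.m≤m+n _ B) le) ⟩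
      a + + m                  ≡⟨ cong (_+_ a) (sym (ℤ.*-identityʳ (+ m))) ⟩
      a + + m * + 1            ≤⟨ ℤ.+-monoʳ-≤ a (ℤ.*-monoˡ-≤-nonNeg (+ m) (h m (ℕ.≤-trans (ℕ.m≤n+m B _) le))) ⟩
      a + + m * evalℤ p (+ m)  ∎
  where
  open ℤ.≤-Reasoning
  -∣a∣≤a : ∀ a → - (+ ∣ a ∣) ≤ a
  -∣a∣≤a (+ n) = ℤ.neg-≤-pos {n} {n}
  -∣a∣≤a -[1+ n ] = ℤ.≤-refl
  lem : ∀ b → + 1 ≡ - b + (+ 1 + b)
  lem = solve-∀
  ≤a : ∀ {m} → suc ∣ a ∣ ℕ.≤ m → + 1 ≤ a + + m
  ≤a {m} le = begin
    + 1                           ≡⟨ lem (+ ∣ a ∣) ⟩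
    - (+ ∣ a ∣) + + (suc ∣ a ∣)   ≤⟨ ℤ.+-mono-≤ (-∣a∣≤a a) (+≤+ le) ⟩
    a + + m                       ∎

positive-cancel : ∀ {u v} → + 1 ≤ u → u * v ≡ + 0 → v ≡ + 0
positive-cancel {u} le eq with ℤ.i*j≡0⇒i≡0∨j≡0 u eq
... | inj₁ refl = ⊥-elim (ℤ.≤⇒≯ le (+<+ (s≤s z≤n)))
... | inj₂ e = e

monic-cancel : ∀ {k f} q → Monic k f → (∀ x → evalℤ f x * evalℤ q x ≡ + 0) → IsZero q
monic-cancel q mf h with monic-positive mf
... | B , pos = eventually-zero q B (λ m le → positive-cancel (pos m le) (h (+ m)))

≈-from-difference : ∀ p q → IsZero (padd p (scale (- + 1) q)) → p ≈ q
≈-from-difference p q z x = begin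
  evalℤ p x ≡⟨ lem (evalℤ p x) (evalℤ q x) ⟩
  evalℤ p x + (- + 1) * evalℤ q x + evalℤ q x ≡⟨ cong (_+ evalℤ q x) (sym (trans (eval-padd p _ x) (cong (_+_ (evalℤ p x)) (eval-scale (- + 1) q x)))) ⟩
  evalℤ (padd p (scale (- + 1) q)) x + evalℤ q x ≡⟨ cong (_+ evalℤ q x) (eval-zero z x) ⟩
  + 0 + evalℤ q x ≡⟨ ℤ.+-identityˡ _ ⟩
  evalℤ q x ∎
  where
  open ≡-Reasoning
  lem : ∀ a b → a ≡ a + (- + 1) * b + b
  lem = solve-∀

monic-cancel-≈ : ∀ {k f} p q → Monic k f → (∀ x → evalℤ f x * evalℤ p x ≡ evalℤ f x * evalℤ q x) → p ≈ q
monic-cancel-≈ {f = f} p q mf h = ≈-from-difference p q (monic-cancel _ mf λ x → begin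
  evalℤ f x * evalℤ (padd p (scale (- + 1) q)) x ≡⟨ cong (evalℤ f x *_) (trans (eval-padd p _ x) (cong (_+_ (evalℤ p x)) (eval-scale (- + 1) q x))) ⟩
  evalℤ f x * (evalℤ p x + (- + 1) * evalℤ q x)  ≡⟨ lem (evalℤ f x) (evalℤ p x) (evalℤ q x) ⟩
  evalℤ f x * evalℤ p x - evalℤ f x * evalℤ q x  ≡⟨ cong (_- evalℤ f x * evalℤ q x) (h x) ⟩
  evalℤ f x * evalℤ q x - evalℤ f x * evalℤ q x  ≡⟨ ℤ.+-inverseʳ (evalℤ f x * evalℤ q x) ⟩
  + 0 ∎)
  where
  open ≡-Reasoning
  lem : ∀ f a b → f * (a + (- + 1) * b) ≡ f * a - f * b
  lem = solve-∀

-- For large x the monic divisor exceeds ∣c r(x)∣, so the cofactor s vanishes there.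
small-multiple-zero : ∀ {m Q} c r s → Monic m Q → length r ℕ.≤ m →
  (∀ x → + suc c * evalℤ r x ≡ evalℤ Q x * evalℤ s x) → IsZero r
small-multiple-zero {m} {Q} c r s mQ l h = eventually-zero r (B₁ ℕ.+ B₂ ℕ.+ B₀) λ k le → r≡0 k
    (proj₂ p₁ k (ℕ.≤-trans (ℕ.m≤m+n B₁ B₂) (ℕ.≤-trans (ℕ.m≤m+n _ B₀) le)))
    (proj₂ p₂ k (ℕ.≤-trans (ℕ.m≤n+m B₂ B₁) (ℕ.≤-trans (ℕ.m≤m+n _ B₀) le)))
    (proj₂ p₀ k (ℕ.≤-trans (ℕ.m≤n+m B₀ (B₁ ℕ.+ B₂)) le))
  where
  l′ : ∀ e → length (scale e r) ℕ.≤ m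
  l′ e = subst (ℕ._≤ m) (sym (List.length-map (e *_) r)) l
  C = + suc c
  -- Both Q + C r and Q - C r are monic of degree m; their eventual positivity says |C r| < Q
  -- without absolute values.
  p₁ = monic-positive (leading-paddˡ (scale C r) (l′ C) mQ)
  p₂ = monic-positive (leading-paddˡ (scale (- C) r) (l′ (- C)) mQ)
  p₀ = monic-positive mQ
  B₁ = proj₁ p₁
  B₂ = proj₁ p₂
  B₀ = proj₁ p₀
  squeeze : ∀ v u → + 1 ≤ v → + 1 ≤ v * u + v → + 1 ≤ - (v * u) + v → u ≡ + 0
  squeeze v@(+ suc _) u _ h₁ h₂ = ℤ.≤-antisym u≤0 0≤u
    where
    e₁ : ∀ v u → v * u + v ≡ v * (+ 1 + u)
    e₁ = solve-∀
    e₂ : ∀ v u → - (v * u) + v ≡ v * (+ 1 - u)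
    e₂ = solve-∀
    pos-factor : ∀ w → + 1 ≤ v * w → + 0 < w
    pos-factor w le = ℤ.*-cancelˡ-<-nonNeg v (ℤ.<-≤-trans (subst (_< + 1) (sym (ℤ.*-zeroʳ v)) (+<+ (s≤s z≤n))) le)
    e₃ : ∀ u → u ≡ - + 1 + (+ 1 + u)
    e₃ = solve-∀
    0≤u : + 0 ≤ u
    0≤u = subst (+ 0 ≤_) (sym (e₃ u)) (ℤ.+-monoʳ-≤ (- + 1) (ℤ.i<j⇒suc[i]≤j (pos-factor _ (subst (+ 1 ≤_) (e₁ v u) h₁))))
    u≤0 : u ≤ + 0
    u≤0 = ℤ.neg-cancel-≤ (subst (+ 0 ≤_) (e₄ u) (ℤ.+-monoʳ-≤ (- + 1) (ℤ.i<j⇒suc[i]≤j (pos-factor _ (subst (+ 1 ≤_) (e₂ v u) h₂)))))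
      where
      e₄ : ∀ u → - + 1 + (+ 1 - u) ≡ - u
      e₄ = solve-∀
  squeeze (+ zero) u (+≤+ ()) h₁ h₂
  r≡0 : ∀ k → + 1 ≤ evalℤ (padd (scale C r) Q) (+ k) → + 1 ≤ evalℤ (padd (scale (- C) r) Q) (+ k) →
        + 1 ≤ evalℤ Q (+ k) → evalℤ r (+ k) ≡ + 0
  r≡0 k h₁ h₂ h₀ = positive-cancel {C} (+≤+ (s≤s z≤n)) (trans (h x) (trans (cong (evalℤ Q x *_) s≡0) (ℤ.*-zeroʳ (evalℤ Q x))))
    where
    x = + k
    h₁′ : + 1 ≤ evalℤ Q x * evalℤ s x + evalℤ Q x
    h₁′ = subst (+ 1 ≤_) (trans (eval-padd (scale C r) Q x) (cong (_+ evalℤ Q x) (trans (eval-scale C r x) (h x)))) h₁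
    h₂′ : + 1 ≤ - (evalℤ Q x * evalℤ s x) + evalℤ Q x
    h₂′ = subst (+ 1 ≤_) (trans (eval-padd (scale (- C) r) Q x) (cong (_+ evalℤ Q x)
      (trans (eval-scale (- C) r x) (trans (sym (ℤ.neg-distribˡ-* C (evalℤ r x))) (cong -_ (h x)))))) h₂
    s≡0 : evalℤ s x ≡ + 0
    s≡0 = squeeze (evalℤ Q x) (evalℤ s x) h₀ h₁′ h₂′

-- Long division

evalBE : List ℤ → ℤ → ℤ
evalBE [] x = + 0
evalBE (c ∷ as) x = c * x ^ length as + evalBE as x

eval-reverse : ∀ p x → evalℤ (reverse p) x ≡ evalBE p x
eval-reverse [] x = refl
eval-reverse (c ∷ as) x
  rewrite List.unfold-reverse c as | eval-++ (reverse as) (c ∷ []) x | List.length-reverse as | eval-reverse as x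
  = lem (evalBE as x) (x ^ length as) c x
  where
  lem : ∀ u y c x → u + y * (c + x * + 0) ≡ c * y + u
  lem = solve-∀

length-psub : ∀ k as bs → length as ≡ k ℕ.+ length bs → length (psub as bs) ≡ length as
length-psub k [] [] eq = refl
length-psub k (a ∷ as) [] eq = refl
length-psub k [] (b ∷ bs) eq = ⊥-elim (ℕ.0≢1+n (trans eq (ℕ.+-suc k _)))
length-psub k (a ∷ as) (b ∷ bs) eq = cong suc (length-psub k as bs (ℕ.suc-injective (trans eq (ℕ.+-suc k _))))

-- Big-endian lists are aligned at their top entries, so the shorter list enters multiplied by x^k,
-- with k the excess length, exactly as in a step of long division.
evalBE-psub : ∀ k as bs x → length as ≡ k ℕ.+ length bs → evalBE (psub as bs) x ≡ evalBE as x - x ^ k * evalBE bs x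
evalBE-psub k [] [] x eq = sym (trans (ℤ.+-identityˡ _) (cong -_ (ℤ.*-zeroʳ (x ^ k))))
evalBE-psub k (a ∷ as) [] x eq = lem _ (x ^ k)
  where
  lem : ∀ u y → u ≡ u - y * + 0
  lem = solve-∀
evalBE-psub k [] (b ∷ bs) x eq = ⊥-elim (ℕ.0≢1+n (trans eq (ℕ.+-suc k _)))
evalBE-psub k (a ∷ as) (b ∷ bs) x eq = begin
  (a - b) * x ^ length (psub as bs) + evalBE (psub as bs) x
    ≡⟨ cong₂ (λ l e → (a - b) * x ^ l + e) (trans (length-psub k as bs eq′) eq′) (evalBE-psub k as bs x eq′) ⟩
  (a - b) * x ^ (k ℕ.+ length bs) + (evalBE as x - x ^ k * evalBE bs x)
    ≡⟨ cong (λ y → (a - b) * y + (evalBE as x - x ^ k * evalBE bs x)) (ℤ.^-distribˡ-+-* x k (length bs)) ⟩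
  (a - b) * (x ^ k * x ^ length bs) + (evalBE as x - x ^ k * evalBE bs x)
    ≡⟨ lem a b (x ^ k) (x ^ length bs) (evalBE as x) (evalBE bs x) ⟩
  a * (x ^ k * x ^ length bs) + evalBE as x - x ^ k * (b * x ^ length bs + evalBE bs x)
    ≡⟨ cong (λ y → a * y + evalBE as x - x ^ k * (b * x ^ length bs + evalBE bs x))
         (sym (trans (cong (x ^_) eq′) (ℤ.^-distribˡ-+-* x k (length bs)))) ⟩
  a * x ^ length as + evalBE as x - x ^ k * (b * x ^ length bs + evalBE bs x) ∎
  where
  open ≡-Reasoning
  eq′ : length as ≡ k ℕ.+ length bs
  eq′ = ℕ.suc-injective (trans eq (ℕ.+-suc k _))
  lem : ∀ a b y z u v → (a - b) * (y * z) + (u - y * v) ≡ a * (y * z) + u - y * (b * z + v)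
  lem = solve-∀

evalBE-scale : ∀ c p x → evalBE (scale c p) x ≡ c * evalBE p x
evalBE-scale c [] x = sym (ℤ.*-zeroʳ c)
evalBE-scale c (a ∷ p) x rewrite evalBE-scale c p x | List.length-map (c *_) p = lem c a (x ^ length p) (evalBE p x)
  where
  lem : ∀ c a x u → c * a * x + c * u ≡ c * (a * x + u)
  lem = solve-∀

record Division (k : ℕ) (c : ℤ) (as bs : List ℤ) : Set where
  field
    tail      : List ℤ
    quotient≡ : divBE (suc k) (c ∷ as) (+ 1 ∷ bs) ≡ c ∷ tail
    length-tail : length tail ≡ k
    remainder : List ℤ
    length-remainder : length remainder ≡ length bs
    division  : ∀ x → evalBE (c ∷ as) x ≡ evalBE (c ∷ tail) x * evalBE (+ 1 ∷ bs) x + evalBE remainder x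

divide : ∀ k c as bs → length as ≡ k ℕ.+ length bs → Division k c as bs
divide zero c as bs eq = record
  { tail = [] ; quotient≡ = refl ; length-tail = refl
  ; remainder = psub as (scale c bs)
  ; length-remainder = trans (length-psub 0 as _ eq′) eq
  ; division = λ x → trans
      (cong₂ (λ l e → c * x ^ l + e) eq (aux x))
      (lem c (x ^ length bs) (evalBE bs x) (evalBE (psub as (scale c bs)) x)) }
  where
  eq′ : length as ≡ length (scale c bs)
  eq′ = trans eq (sym (List.length-map (c *_) bs))
  aux : ∀ x → evalBE as x ≡ evalBE (psub as (scale c bs)) x + c * evalBE bs x
  aux x = trans (l₂ (evalBE as x) (c * evalBE bs x)) (cong (_+ c * evalBE bs x)
     (sym (trans (evalBE-psub 0 as _ x eq′) (cong (λ e → evalBE as x - + 1 * e) (evalBE-scale c bs x)))))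
    where
    l₂ : ∀ u v → u ≡ u - + 1 * v + v
    l₂ = solve-∀
  lem : ∀ c y b r → c * y + (r + c * b) ≡ (c * + 1 + + 0) * (+ 1 * y + b) + r
  lem = solve-∀
-- The difference still has suc k + length bs entries, so it has a head c′, which is the next
-- coefficient of the quotient.
divide (suc k) c as bs eq with psub as (scale c bs) in ps
                             | length-psub (suc k) as (scale c bs) (trans eq (cong (suc k ℕ.+_) (sym (List.length-map (c *_) bs))))
                             | (λ x → evalBE-psub (suc k) as (scale c bs) x (trans eq (cong (suc k ℕ.+_) (sym (List.length-map (c *_) bs)))))
... | [] | len | _ = ⊥-elim (ℕ.0≢1+n (trans len eq))
... | c′ ∷ as′ | len | ev with divide k c′ as′ bs (ℕ.suc-injective (trans len eq))
... | d = record
  { tail = c′ ∷ tail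
  ; quotient≡ = cong (c ∷_) (trans (cong (λ a → divBE (suc k) a (+ 1 ∷ bs)) ps) quotient≡)
  ; length-tail = cong suc length-tail
  ; remainder = remainder
  ; length-remainder = length-remainder
  ; division = λ x → begin
      c * x ^ length as + evalBE as x
        ≡⟨ cong₂ (λ l e → c * l + e) (trans (cong (x ^_) eq) (ℤ.^-distribˡ-+-* x (suc k) (length bs))) (aux x) ⟩
      c * (x ^ suc k * x ^ length bs) + (evalBE (c′ ∷ as′) x + x ^ suc k * (c * evalBE bs x))
        ≡⟨ cong (λ e → c * (x ^ suc k * x ^ length bs) + (e + x ^ suc k * (c * evalBE bs x))) (division x) ⟩
      c * (x ^ suc k * x ^ length bs) + (evalBE (c′ ∷ tail) x * evalBE (+ 1 ∷ bs) x + evalBE remainder x + x ^ suc k * (c * evalBE bs x))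
        ≡⟨ lem c (x ^ suc k) (x ^ length bs) (evalBE bs x) (evalBE (c′ ∷ tail) x) (evalBE remainder x) ⟩
      (c * x ^ suc k + evalBE (c′ ∷ tail) x) * (+ 1 * x ^ length bs + evalBE bs x) + evalBE remainder x
        ≡⟨ cong (λ l → (c * x ^ l + evalBE (c′ ∷ tail) x) * evalBE (+ 1 ∷ bs) x + evalBE remainder x) (cong suc (sym length-tail)) ⟩
      evalBE (c ∷ c′ ∷ tail) x * evalBE (+ 1 ∷ bs) x + evalBE remainder x ∎
  }
  where
  open Division d
  open ≡-Reasoning
  aux : ∀ x → evalBE as x ≡ evalBE (c′ ∷ as′) x + x ^ suc k * (c * evalBE bs x)
  aux x = trans (l₂ (evalBE as x) (x ^ suc k * (c * evalBE bs x))) (cong (_+ x ^ suc k * (c * evalBE bs x))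
     (sym (trans (ev x) (cong (λ e → evalBE as x - x ^ suc k * e) (evalBE-scale c bs x)))))
    where
    l₂ : ∀ u v → u ≡ u - v + v
    l₂ = solve-∀
  lem : ∀ c y z b q r → c * (y * z) + (q * (+ 1 * z + b) + r + y * (c * b)) ≡ (c * y + q) * (+ 1 * z + b) + r
  lem = solve-∀

-- Only a positive multiple of p is assumed divisible by Q, which is all that comaximality up to an
-- integer yields. For the remainder r, suc c · r is Q times a polynomial while r has at most m
-- coefficients, so r vanishes by `small-multiple-zero`.
pdiv-exact : ∀ k {m p Q} c s → Monic (k ℕ.+ m) p → Monic m Q →
  (∀ x → + suc c * evalℤ p x ≡ evalℤ Q x * evalℤ s x) →
  Monic k (pdiv p Q) × (∀ x → evalℤ (pdiv p Q) x * evalℤ Q x ≡ evalℤ p x)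
pdiv-exact k {m} {p} {Q} c s mp mQ h
  with monic-∷ʳ⁻¹ mp | monic-∷ʳ⁻¹ mQ
... | p′ , refl , lp | Q′ , refl , lQ = result
  where
  as = reverse p′
  bs = reverse Q′
  rev-p : reverse p ≡ + 1 ∷ as
  rev-p = List.reverse-++ p′ (+ 1 ∷ [])
  rev-Q : reverse Q ≡ + 1 ∷ bs
  rev-Q = List.reverse-++ Q′ (+ 1 ∷ [])
  len-bs : length bs ≡ m
  len-bs = trans (List.length-reverse Q′) lQ
  d : Division k (+ 1) as bs
  d = divide k (+ 1) as bs (trans (trans (List.length-reverse p′) lp) (cong (k ℕ.+_) (sym len-bs)))
  open Division d
  len : length p ℕ.∸ length Q ≡ k
  len = trans (cong₂ ℕ._∸_ (leading-length mp) (leading-length mQ)) (ℕ.m+n∸n≡m k m)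
  pdiv≡ : pdiv p Q ≡ reverse (+ 1 ∷ tail)
  pdiv≡ = cong reverse (trans (cong (λ l → divBE (suc l) (reverse p) (reverse Q)) len)
            (trans (cong₂ (divBE (suc k)) rev-p rev-Q) quotient≡))
  evalBE-of : ∀ q a bs → reverse q ≡ a ∷ bs → ∀ x → evalℤ q x ≡ evalBE (a ∷ bs) x
  evalBE-of q a bs eq x = trans (cong (λ r → evalℤ r x) (trans (sym (List.reverse-involutive q)) (cong reverse eq))) (eval-reverse (a ∷ bs) x)
  r = reverse remainder
  div : ∀ x → evalℤ p x ≡ evalℤ (pdiv p Q) x * evalℤ Q x + evalℤ r x
  div x = begin
    evalℤ p x ≡⟨ evalBE-of p (+ 1) as rev-p x ⟩
    evalBE (+ 1 ∷ as) x ≡⟨ division x ⟩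
    evalBE (+ 1 ∷ tail) x * evalBE (+ 1 ∷ bs) x + evalBE remainder x
      ≡⟨ cong₂ _+_ (cong₂ _*_ (sym (trans (cong (λ q → evalℤ q x) pdiv≡) (eval-reverse (+ 1 ∷ tail) x))) (sym (evalBE-of Q (+ 1) bs rev-Q x))) (sym (eval-reverse remainder x)) ⟩
    evalℤ (pdiv p Q) x * evalℤ Q x + evalℤ r x ∎
    where open ≡-Reasoning
  t : Poly
  t = padd s (scale (- + suc c) (pdiv p Q))
  multiple : ∀ x → + suc c * evalℤ r x ≡ evalℤ Q x * evalℤ t x
  multiple x = begin
    C * evalℤ r x ≡⟨ lem C (evalℤ r x) (evalℤ (pdiv p Q) x) (evalℤ Q x) ⟩
    C * (evalℤ (pdiv p Q) x * evalℤ Q x + evalℤ r x) - C * evalℤ (pdiv p Q) x * evalℤ Q x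
      ≡⟨ cong (λ e → C * e - C * evalℤ (pdiv p Q) x * evalℤ Q x) (sym (div x)) ⟩
    C * evalℤ p x - C * evalℤ (pdiv p Q) x * evalℤ Q x
      ≡⟨ cong (_- C * evalℤ (pdiv p Q) x * evalℤ Q x) (h x) ⟩
    evalℤ Q x * evalℤ s x - C * evalℤ (pdiv p Q) x * evalℤ Q x
      ≡⟨ lem₂ (evalℤ Q x) (evalℤ s x) C (evalℤ (pdiv p Q) x) ⟩
    evalℤ Q x * (evalℤ s x + (- C) * evalℤ (pdiv p Q) x)
      ≡⟨ cong (evalℤ Q x *_) (sym (trans (eval-padd s _ x) (cong (_+_ (evalℤ s x)) (eval-scale (- C) (pdiv p Q) x)))) ⟩
    evalℤ Q x * evalℤ t x ∎
    where
    open ≡-Reasoning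
    C = + suc c
    lem : ∀ C r q Q → C * r ≡ C * (q * Q + r) - C * q * Q
    lem = solve-∀
    lem₂ : ∀ Q s C q → Q * s - C * q * Q ≡ Q * (s + (- C) * q)
    lem₂ = solve-∀
  r-zero : IsZero r
  r-zero = small-multiple-zero c r t mQ
    (ℕ.≤-reflexive (trans (List.length-reverse remainder) (trans length-remainder len-bs))) multiple
  result : Monic k (pdiv p Q) × (∀ x → evalℤ (pdiv p Q) x * evalℤ Q x ≡ evalℤ p x)
  result =
    subst (Monic k) (sym (trans pdiv≡ (List.unfold-reverse (+ 1) tail)))
      (subst (λ l → Monic l (reverse tail ++ + 1 ∷ [])) (trans (List.length-reverse tail) length-tail) (monic-∷ʳ (reverse tail))) ,
    λ x → sym (trans (div x) (trans (cong (_+_ (evalℤ (pdiv p Q) x * evalℤ Q x)) (eval-zero r-zero x)) (ℤ.+-identityʳ _)))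

monic-xnm1 : ∀ m → Monic (suc m) (xnm1 (suc m))
monic-xnm1 m = cons _ (subst (λ l → Monic l (replicate m (+ 0) ++ + 1 ∷ [])) (List.length-replicate m) (monic-∷ʳ _))

eval-replicate-0 : ∀ m x → evalℤ (replicate m (+ 0)) x ≡ + 0
eval-replicate-0 zero x = refl
eval-replicate-0 (suc m) x rewrite eval-replicate-0 m x = trans (ℤ.+-identityˡ _) (ℤ.*-zeroʳ x)

eval-xnm1 : ∀ m x → evalℤ (xnm1 (suc m)) x ≡ x ^ suc m - + 1
eval-xnm1 m x rewrite eval-++ (replicate m (+ 0)) (+ 1 ∷ []) x | List.length-replicate m {+ 0} | eval-replicate-0 m x
  = lem x (x ^ m)
  where
  lem : ∀ x y → - + 1 + x * (+ 0 + y * (+ 1 + x * + 0)) ≡ x * y - + 1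
  lem = solve-∀

-- Polynomials acting on two-sided sequences, x being the shift

act : Poly → (ℤ → ℤ) → ℤ → ℤ
act [] u m = + 0
act (a ∷ p) u m = a * u m + act p u (m - + 1)

act-padd : ∀ p q u m → act (padd p q) u m ≡ act p u m + act q u m
act-padd [] q u m = sym (ℤ.+-identityˡ _)
act-padd (a ∷ p) [] u m = sym (ℤ.+-identityʳ _)
act-padd (a ∷ p) (b ∷ q) u m rewrite act-padd p q u (m - + 1) = lem a b (u m) (act p u (m - + 1)) (act q u (m - + 1))
  where
  lem : ∀ a b x u v → (a + b) * x + (u + v) ≡ a * x + u + (b * x + v)
  lem = solve-∀

act-scale : ∀ c p u m → act (scale c p) u m ≡ c * act p u m
act-scale c [] u m = sym (ℤ.*-zeroʳ c)
act-scale c (a ∷ p) u m rewrite act-scale c p u (m - + 1) = lem c a (u m) (act p u (m - + 1))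
  where
  lem : ∀ c a x u → c * a * x + c * u ≡ c * (a * x + u)
  lem = solve-∀

act-shift : ∀ p u m → act (+ 0 ∷ p) u m ≡ act p u (m - + 1)
act-shift p u m = ℤ.+-identityˡ _

act-pmul : ∀ p q u m → act (pmul p q) u m ≡ act p (act q u) m
act-pmul [] q u m = refl
act-pmul (a ∷ p) q u m = begin
  act (padd (scale a q) (+ 0 ∷ pmul p q)) u m               ≡⟨ act-padd (scale a q) _ u m ⟩
  act (scale a q) u m + act (+ 0 ∷ pmul p q) u m            ≡⟨ cong₂ _+_ (act-scale a q u m) (act-shift (pmul p q) u m) ⟩
  a * act q u m + act (pmul p q) u (m - + 1)                ≡⟨ cong (_+_ (a * act q u m)) (act-pmul p q u (m - + 1)) ⟩
  a * act q u m + act p (act q u) (m - + 1)                 ∎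
  where open ≡-Reasoning

act-zero : ∀ {p} → IsZero p → ∀ u m → act p u m ≡ + 0
act-zero [] u m = refl
act-zero {_ ∷ p} (refl ∷ z) u m = trans (act-shift p u m) (act-zero z u (m - + 1))

-- Equal values give equal coefficients up to padding, and padding acts as zero. Identities proved
-- pointwise thereby become operator identities on sequences.
act-≈ : ∀ p q → p ≈ q → ∀ u m → act p u m ≡ act q u m
act-≈ p q p≈q u m = begin
  act p u m                                      ≡⟨ lem (act p u m) (act q u m) ⟩
  act p u m + (- + 1) * act q u m + act q u m    ≡⟨ cong (_+ act q u m) (sym (trans (act-padd p _ u m) (cong (_+_ (act p u m)) (act-scale (- + 1) q u m)))) ⟩
  act (padd p (scale (- + 1) q)) u m + act q u m ≡⟨ cong (_+ act q u m) (act-zero zero-difference u m) ⟩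
  + 0 + act q u m                                ≡⟨ ℤ.+-identityˡ _ ⟩
  act q u m                                      ∎
  where
  open ≡-Reasoning
  lem : ∀ a b → a ≡ a + (- + 1) * b + b
  lem = solve-∀
  lem₂ : ∀ a → a + (- + 1) * a ≡ + 0
  lem₂ = solve-∀
  zero-difference : IsZero (padd p (scale (- + 1) q))
  zero-difference = eventually-zero _ 0 λ k _ →
    trans (eval-padd p _ (+ k)) (trans (cong₂ _+_ (p≈q (+ k)) (eval-scale (- + 1) q (+ k))) (lem₂ (evalℤ q (+ k))))

act-translate : ∀ p u i → (∀ m → u (m + i) ≡ u m) → ∀ m → act p u (m + i) ≡ act p u m
act-translate [] u i h m = refl
act-translate (a ∷ p) u i h m = cong₂ (λ y z → a * y + z) (h m)
  (trans (cong (act p u) (lem m i)) (act-translate p u i h (m - + 1)))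
  where
  lem : ∀ m i → m + i - + 1 ≡ m - + 1 + i
  lem = solve-∀

-- For u = `act p c` and i = 0 this is the Toeplitz form, the sum of p_j p_l c(j - l).
dot : Poly → (ℤ → ℤ) → ℕ → ℤ
dot [] u i = + 0
dot (a ∷ p) u i = a * u (+ i) + dot p u (suc i)

dot-leading : ∀ {ℓ k p} u i → Leading ℓ k p → (∀ j → j ℕ.< k → u (+ (i ℕ.+ j)) ≡ + 0) → dot p u i ≡ ℓ * u (+ (i ℕ.+ k))
dot-leading {ℓ} u i top h rewrite ℕ.+-identityʳ i = ℤ.+-identityʳ _
dot-leading {ℓ} {suc k} {a ∷ p} u i (cons a l) h = begin
  a * u (+ i) + dot p u (suc i)
    ≡⟨ cong₂ (λ y z → a * y + z) (trans (cong (λ n → u (+ n)) (sym (ℕ.+-identityʳ i))) (h 0 (s≤s z≤n)))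
         (dot-leading u (suc i) l (λ j j<k → trans (cong (λ n → u (+ n)) (sym (ℕ.+-suc i j))) (h (suc j) (s≤s j<k)))) ⟩
  a * + 0 + ℓ * u (+ suc (i ℕ.+ k)) ≡⟨ lem a _ ⟩
  ℓ * u (+ suc (i ℕ.+ k))           ≡⟨ cong (λ n → ℓ * u (+ n)) (sym (ℕ.+-suc i k)) ⟩
  ℓ * u (+ (i ℕ.+ suc k))           ∎
  where
  open ≡-Reasoning
  lem : ∀ a b → a * + 0 + b ≡ b
  lem = solve-∀

dot-zero : ∀ p u i → (∀ j → j ℕ.< length p → u (+ (i ℕ.+ j)) ≡ + 0) → dot p u i ≡ + 0
dot-zero [] u i h = refl
dot-zero (a ∷ p) u i h
  rewrite trans (cong (λ n → u (+ n)) (sym (ℕ.+-identityʳ i))) (h 0 (s≤s z≤n))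
        | dot-zero p u (suc i) (λ j j<k → trans (cong (λ n → u (+ n)) (sym (ℕ.+-suc i j))) (h (suc j) (s≤s j<k)))
  = trans (ℤ.+-identityʳ _) (ℤ.*-zeroʳ a)

-- Taylor coefficients at 1

-- The coefficient of y^j in p(1 + y), computed from a + x p = a + p + y p.
tcoef : ℕ → Poly → ℤ
tcoef j [] = + 0
tcoef zero (a ∷ p) = a + tcoef zero p
tcoef (suc j) (a ∷ p) = tcoef (suc j) p + tcoef j p

tcoef-padd : ∀ j p q → tcoef j (padd p q) ≡ tcoef j p + tcoef j q
tcoef-padd j [] q = sym (ℤ.+-identityˡ _)
tcoef-padd j (a ∷ p) [] = sym (ℤ.+-identityʳ _)
tcoef-padd zero (a ∷ p) (b ∷ q) rewrite tcoef-padd zero p q = lem a b (tcoef 0 p) (tcoef 0 q)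
  where
  lem : ∀ a b u v → a + b + (u + v) ≡ a + u + (b + v)
  lem = solve-∀
tcoef-padd (suc j) (a ∷ p) (b ∷ q) rewrite tcoef-padd (suc j) p q | tcoef-padd j p q = lem (tcoef (suc j) p) (tcoef (suc j) q) (tcoef j p) (tcoef j q)
  where
  lem : ∀ a b u v → a + b + (u + v) ≡ a + u + (b + v)
  lem = solve-∀

tcoef-scale : ∀ j c p → tcoef j (scale c p) ≡ c * tcoef j p
tcoef-scale j c [] = sym (ℤ.*-zeroʳ c)
tcoef-scale zero c (a ∷ p) rewrite tcoef-scale zero c p = sym (ℤ.*-distribˡ-+ c a _)
tcoef-scale (suc j) c (a ∷ p) rewrite tcoef-scale (suc j) c p | tcoef-scale j c p = sym (ℤ.*-distribˡ-+ c _ _)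

tcoef-zero : ∀ {p} → IsZero p → ∀ j → tcoef j p ≡ + 0
tcoef-zero [] j = refl
tcoef-zero (refl ∷ z) zero rewrite tcoef-zero z 0 = refl
tcoef-zero (refl ∷ z) (suc j) rewrite tcoef-zero z (suc j) | tcoef-zero z j = refl

tcoef-high : ∀ j p → length p ℕ.≤ j → tcoef j p ≡ + 0
tcoef-high j [] l = refl
tcoef-high (suc j) (a ∷ p) (s≤s l) rewrite tcoef-high (suc j) p (ℕ.m≤n⇒m≤1+n l) | tcoef-high j p l = refl

length-padd : ∀ {n} p q → length p ℕ.≤ n → length q ℕ.≤ n → length (padd p q) ℕ.≤ n
length-padd [] q lp lq = lq
length-padd (a ∷ p) [] lp lq = lp
length-padd (a ∷ p) (b ∷ q) (s≤s lp) (s≤s lq) = s≤s (length-padd p q lp lq)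

length-scale : ∀ {n} c p → length p ℕ.≤ n → length (scale c p) ℕ.≤ n
length-scale c p l = subst (ℕ._≤ _) (sym (List.length-map (c *_) p)) l

-- g is p - ℓ f with the cancelled top entry dropped. The shorter list is essential: definiteness of
-- the form is known only for lists of at most k entries.
cancel-leading : ∀ {ℓ k p f} → Leading ℓ k p → Monic k f → ∃ λ g → length g ≡ k ×
  (∀ u m → act g u m ≡ act p u m - ℓ * act f u m) × (∀ j → tcoef j g ≡ tcoef j p - ℓ * tcoef j f)
cancel-leading {ℓ} top top = [] , refl , (λ u m → lem ℓ (u m)) , λ { zero → lem₂ ℓ ; (suc j) → lem₃ ℓ }
  where
  lem : ∀ ℓ x → + 0 ≡ ℓ * x + + 0 - ℓ * (+ 1 * x + + 0)
  lem = solve-∀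
  lem₂ : ∀ ℓ → + 0 ≡ ℓ + + 0 - ℓ * (+ 1 + + 0)
  lem₂ = solve-∀
  lem₃ : ∀ ℓ → + 0 ≡ + 0 + + 0 - ℓ * (+ 0 + + 0)
  lem₃ = solve-∀
cancel-leading {ℓ} {p = a ∷ p} {f = b ∷ f} (cons a l) (cons b m) with cancel-leading l m
... | g , len , ha , ht = (a - ℓ * b) ∷ g , cong suc len ,
    (λ u m → trans (cong (_+_ ((a - ℓ * b) * u m)) (ha u (m - + 1))) (lem a ℓ b (u m) (act p u (m - + 1)) (act f u (m - + 1)))) ,
    λ { zero → trans (cong (_+_ (a - ℓ * b)) (ht 0)) (lem₂ a ℓ b (tcoef 0 p) (tcoef 0 f))
      ; (suc j) → trans (cong₂ _+_ (ht (suc j)) (ht j)) (lem₃ ℓ (tcoef (suc j) p) (tcoef (suc j) f) (tcoef j p) (tcoef j f)) }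
  where
  lem : ∀ a ℓ b x u v → (a - ℓ * b) * x + (u - ℓ * v) ≡ a * x + u - ℓ * (b * x + v)
  lem = solve-∀
  lem₂ : ∀ a ℓ b u v → a - ℓ * b + (u - ℓ * v) ≡ a + u - ℓ * (b + v)
  lem₂ = solve-∀
  lem₃ : ∀ ℓ u v y z → u - ℓ * v + (y - ℓ * z) ≡ u + y - ℓ * (v + z)
  lem₃ = solve-∀

0<-product : ∀ {a b} → + 0 < a → + 0 < b → + 0 < a * b
0<-product {+ suc a} {b} (+<+ _) 0<b = subst (_< + suc a * b) (ℤ.*-zeroʳ (+ suc a)) (ℤ.*-monoˡ-<-pos (+ suc a) 0<b)

0≤-product : ∀ {a b} → + 0 ≤ a → + 0 ≤ b → + 0 ≤ a * b
0≤-product {+ a} {b} _ 0≤b = subst (_≤ + a * b) (ℤ.*-zeroʳ (+ a)) (ℤ.*-monoˡ-≤-nonNeg (+ a) 0≤b)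

0<-factor : ∀ {a b} → + 0 < a → + 0 < a * b → + 0 < b
0<-factor {+ suc a} {b} _ h = ℤ.*-cancelˡ-<-nonNeg (+ suc a) (subst (_< + suc a * b) (sym (ℤ.*-zeroʳ (+ suc a))) h)
0<-factor {+ 0} (+<+ ()) h

0≤-sum : ∀ {a b} → + 0 ≤ a → + 0 ≤ b → + 0 ≤ a + b
0≤-sum = ℤ.+-mono-≤

0<-sum : ∀ {a b} → + 0 ≤ a → + 0 < b → + 0 < a + b
0<-sum = ℤ.+-mono-≤-<

-- Szegő recursion for a positive semidefinite Toeplitz form with symbol c

-- `act φₖ c i` is the pairing of φₖ with x^i, so φₖ is the orthogonal polynomial of degree k with
-- leading coefficient ℓ. The reversal ψₖ is described only through its pairings. The two bounds are
-- the inductive invariant: each Taylor coefficient of ψₖ is at most that of φₖ in absolute value.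
record Szegő (c : ℤ → ℤ) (k : ℕ) : Set where
  field
    φₖ ψₖ    : Poly
    ℓ        : ℤ
    leading  : Leading ℓ k φₖ
    0<ℓ      : + 0 < ℓ
    length-ψ : length ψₖ ℕ.≤ suc k
    reversal : ∀ i → act ψₖ c i ≡ act φₖ c (+ k - i)
    orthogonal : ∀ i → i ℕ.< k → act φₖ c (+ i) ≡ + 0
    0<norm   : + 0 < act φₖ c (+ k)
    bound⁺   : ∀ j → + 0 ≤ tcoef j φₖ + tcoef j ψₖ
    bound⁻   : ∀ j → + 0 ≤ tcoef j φₖ - tcoef j ψₖ
    0≤tcoef  : ∀ j → + 0 ≤ tcoef j φₖ
    0<tcoef  : ∀ j → j ℕ.≤ k → + 0 < tcoef j φₖ

module Step {c : ℤ → ℤ} {k : ℕ} (S : Szegő c k) where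
  open Szegő S

  A : ℤ → ℤ
  A = act φₖ c

  -- a pairs x φ with 1, and b pairs ψ with 1 (equally φ with x^k). The combination b x φ - a ψ is
  -- therefore orthogonal to 1 as well.
  a b : ℤ
  a = A (- + 1)
  b = A (+ k)

  φ⁺ ψ⁺ : Poly
  φ⁺ = padd (scale (- a) ψₖ) (scale b (+ 0 ∷ φₖ))
  ψ⁺ = padd (scale b ψₖ) (scale (- a) (+ 0 ∷ φₖ))

  X : ℕ → ℤ
  X j = tcoef j (+ 0 ∷ φₖ)

  private
    rearrange : ∀ a b u v → (- a) * v + b * u ≡ b * u - a * v
    rearrange = solve-∀
    rearrange′ : ∀ a b u v → b * v + (- a) * u ≡ b * v - a * u
    rearrange′ = solve-∀

  act-φ⁺ : ∀ i → act φ⁺ c i ≡ b * A (i - + 1) - a * A (+ k - i)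
  act-φ⁺ i = begin
    act φ⁺ c i ≡⟨ act-padd (scale (- a) ψₖ) _ c i ⟩
    act (scale (- a) ψₖ) c i + act (scale b (+ 0 ∷ φₖ)) c i
      ≡⟨ cong₂ _+_ (trans (act-scale (- a) ψₖ c i) (cong ((- a) *_) (reversal i)))
                   (trans (act-scale b (+ 0 ∷ φₖ) c i) (cong (b *_) (act-shift φₖ c i))) ⟩
    (- a) * A (+ k - i) + b * A (i - + 1) ≡⟨ rearrange a b _ _ ⟩
    b * A (i - + 1) - a * A (+ k - i) ∎
    where open ≡-Reasoning

  act-ψ⁺ : ∀ i → act ψ⁺ c i ≡ b * A (+ k - i) - a * A (i - + 1)
  act-ψ⁺ i = begin
    act ψ⁺ c i ≡⟨ act-padd (scale b ψₖ) _ c i ⟩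
    act (scale b ψₖ) c i + act (scale (- a) (+ 0 ∷ φₖ)) c i
      ≡⟨ cong₂ _+_ (trans (act-scale b ψₖ c i) (cong (b *_) (reversal i)))
                   (trans (act-scale (- a) (+ 0 ∷ φₖ) c i) (cong ((- a) *_) (act-shift φₖ c i))) ⟩
    b * A (+ k - i) + (- a) * A (i - + 1) ≡⟨ rearrange′ a b _ _ ⟩
    b * A (+ k - i) - a * A (i - + 1) ∎
    where open ≡-Reasoning

  tcoef-φ⁺ : ∀ j → tcoef j φ⁺ ≡ b * X j - a * tcoef j ψₖ
  tcoef-φ⁺ j = trans (tcoef-padd j (scale (- a) ψₖ) _)
    (trans (cong₂ _+_ (tcoef-scale j (- a) ψₖ) (tcoef-scale j b (+ 0 ∷ φₖ))) (rearrange a b _ _))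

  tcoef-ψ⁺ : ∀ j → tcoef j ψ⁺ ≡ b * tcoef j ψₖ - a * X j
  tcoef-ψ⁺ j = trans (tcoef-padd j (scale b ψₖ) _)
    (trans (cong₂ _+_ (tcoef-scale j b ψₖ) (tcoef-scale j (- a) (+ 0 ∷ φₖ))) (rearrange′ a b _ _))

  leading⁺ : Leading (b * ℓ) (suc k) φ⁺
  leading⁺ = leading-paddˡ (scale (- a) ψₖ) (length-scale (- a) ψₖ length-ψ) (leading-scale b (cons (+ 0) leading))

  reversal⁺ : ∀ i → act ψ⁺ c i ≡ act φ⁺ c (+ suc k - i)
  reversal⁺ i = trans (act-ψ⁺ i) (sym (trans (act-φ⁺ (+ suc k - i))
    (cong₂ (λ u v → b * A u - a * A v) (lem (+ k) i) (lem₂ (+ k) i))))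
    where
    lem : ∀ k i → + 1 + k - i - + 1 ≡ k - i
    lem = solve-∀
    lem₂ : ∀ k i → k - (+ 1 + k - i) ≡ i - + 1
    lem₂ = solve-∀

  orthogonal⁺ : ∀ i → i ℕ.< suc k → act φ⁺ c (+ i) ≡ + 0
  orthogonal⁺ zero _ = trans (act-φ⁺ (+ 0)) (trans (cong (λ z → b * a - a * A z) (ℤ.+-identityʳ (+ k))) (lem a b))
    where
    lem : ∀ a b → b * a - a * b ≡ + 0
    lem = solve-∀
  orthogonal⁺ (suc i) (s≤s i<k) = trans (act-φ⁺ (+ suc i)) (trans (cong₂ (λ u v → b * u - a * v) (orthogonal i i<k) z) (lem a b))
    where
    lem : ∀ a b → b * + 0 - a * + 0 ≡ + 0
    lem = solve-∀
    z : A (+ k - + suc i) ≡ + 0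
    z = trans (cong A (trans (ℤ.[+m]-[+n]≡m⊖n k (suc i)) (ℤ.⊖-≥ i<k))) (orthogonal (k ℕ.∸ suc i) (ℕ.∸-monoʳ-< {k} (s≤s z≤n) i<k))

  -- As b > 0, positivity of this quantity means b > |a|, and its vanishing marks the last step.
  norm⁺ : act φ⁺ c (+ suc k) ≡ (b - a) * (b + a)
  norm⁺ = trans (act-φ⁺ (+ suc k)) (trans (cong (λ u → b * b - a * A u) (lem (+ k))) (lem₂ a b))
    where
    lem : ∀ k → k - (+ 1 + k) ≡ - + 1
    lem = solve-∀
    lem₂ : ∀ a b → b * b - a * a ≡ (b - a) * (b + a)
    lem₂ = solve-∀

  0<ℓ⁺ : + 0 < b * ℓ
  0<ℓ⁺ = 0<-product 0<norm 0<ℓ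

  -- From x φ ± ψ = (φ ± ψ) + y φ: the invariant plus a shifted copy of the coefficients of φ, which
  -- adds nothing at order 0.
  0≤X±ψ : ∀ j → + 0 ≤ X j + tcoef j ψₖ × + 0 ≤ X j - tcoef j ψₖ
  0≤X±ψ zero = subst (+ 0 ≤_) (lem (tcoef 0 φₖ) _) (bound⁺ 0) , subst (+ 0 ≤_) (lem′ (tcoef 0 φₖ) _) (bound⁻ 0)
    where
    lem : ∀ u v → u + v ≡ + 0 + u + v
    lem = solve-∀
    lem′ : ∀ u v → u - v ≡ + 0 + u - v
    lem′ = solve-∀
  0≤X±ψ (suc j) = subst (+ 0 ≤_) (lem (tcoef (suc j) φₖ) _ _) (0≤-sum (bound⁺ (suc j)) (0≤tcoef j)) ,
                  subst (+ 0 ≤_) (lem′ (tcoef (suc j) φₖ) _ _) (0≤-sum (bound⁻ (suc j)) (0≤tcoef j))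
    where
    lem : ∀ u v w → u + v + w ≡ u + w + v
    lem = solve-∀
    lem′ : ∀ u v w → u - v + w ≡ u + w - v
    lem′ = solve-∀

  -- Here y φ supplies strictness, hence the index `suc j`. At order 0 it may fail: for φ = ψ = 1, x
  -- φ - ψ = x - 1 vanishes at 1.
  0<X±ψ : ∀ j → j ℕ.≤ k → + 0 < X (suc j) + tcoef (suc j) ψₖ × + 0 < X (suc j) - tcoef (suc j) ψₖ
  0<X±ψ j j≤k = subst (+ 0 <_) (lem (tcoef (suc j) φₖ) _ _) (0<-sum (bound⁺ (suc j)) (0<tcoef j j≤k)) ,
                subst (+ 0 <_) (lem′ (tcoef (suc j) φₖ) _ _) (0<-sum (bound⁻ (suc j)) (0<tcoef j j≤k))
    where
    lem : ∀ u v w → u + v + w ≡ u + w + v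
    lem = solve-∀
    lem′ : ∀ u v w → u - v + w ≡ u + w - v
    lem′ = solve-∀

  0≤X : ∀ j → + 0 ≤ X j
  0≤X zero = 0≤-sum ℤ.≤-refl (0≤tcoef 0)
  0≤X (suc j) = 0≤-sum (0≤tcoef (suc j)) (0≤tcoef j)

  0<X : ∀ j → j ℕ.≤ suc k → + 0 < X j
  0<X zero _ = 0<-sum ℤ.≤-refl (0<tcoef 0 z≤n)
  0<X (suc j) (s≤s j≤k) = 0<-sum (0≤tcoef (suc j)) (0<tcoef j j≤k)

  next : + 0 < act φ⁺ c (+ suc k) → Szegő c (suc k)
  next 0<norm⁺ = record
    { φₖ = φ⁺ ; ψₖ = ψ⁺ ; ℓ = b * ℓ ; leading = leading⁺ ; 0<ℓ = 0<ℓ⁺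
    ; length-ψ = length-padd (scale b ψₖ) (scale (- a) (+ 0 ∷ φₖ)) (length-scale b ψₖ (ℕ.m≤n⇒m≤1+n length-ψ))
        (length-scale (- a) (+ 0 ∷ φₖ) (ℕ.≤-reflexive (cong suc (leading-length leading))))
    ; reversal = reversal⁺ ; orthogonal = orthogonal⁺ ; 0<norm = 0<norm⁺
    ; bound⁺ = λ j → subst (+ 0 ≤_) (sym (trans (cong₂ _+_ (tcoef-φ⁺ j) (tcoef-ψ⁺ j)) (lem⁺ a b (X j) (tcoef j ψₖ))))
        (0≤-product (ℤ.<⇒≤ 0<b-a) (proj₁ (0≤X±ψ j)))
    ; bound⁻ = λ j → subst (+ 0 ≤_) (sym (trans (cong₂ _-_ (tcoef-φ⁺ j) (tcoef-ψ⁺ j)) (lem⁻ a b (X j) (tcoef j ψₖ))))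
        (0≤-product (ℤ.<⇒≤ 0<b+a) (proj₂ (0≤X±ψ j)))
    ; 0≤tcoef = λ j → ℤ.≤-trans (0≤X j) (X≤ j)
    ; 0<tcoef = λ j j≤ → ℤ.<-≤-trans (0<X j j≤) (X≤ j)
    }
    where
    lem⁺ : ∀ a b x y → b * x - a * y + (b * y - a * x) ≡ (b - a) * (x + y)
    lem⁺ = solve-∀
    lem⁻ : ∀ a b x y → b * x - a * y - (b * y - a * x) ≡ (b + a) * (x - y)
    lem⁻ = solve-∀
    0<product : + 0 < (b - a) * (b + a)
    0<product = subst (+ 0 <_) norm⁺ 0<norm⁺
    both-positive : ∀ u v → + 0 < u + v → + 0 < u * v → + 0 < u × + 0 < v
    both-positive (+ suc u) v _ h = +<+ (s≤s z≤n) , 0<-factor {+ suc u} (+<+ (s≤s z≤n)) h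
    both-positive (+ 0) v _ (+<+ ())
    both-positive -[1+ u ] (+ 0) ()
    both-positive -[1+ u ] (+ suc v) _ ()
    both-positive -[1+ u ] -[1+ v ] ()
    lem₂ : ∀ a b → b + b ≡ b - a + (b + a)
    lem₂ = solve-∀
    -- The product of b - a and b + a is the new norm and their sum is 2b; both being positive, so
    -- is each factor.
    both = both-positive (b - a) (b + a) (subst (+ 0 <_) (lem₂ a b) (0<-sum (ℤ.<⇒≤ 0<norm) 0<norm)) 0<product
    0<b-a : + 0 < b - a
    0<b-a = proj₁ both
    0<b+a : + 0 < b + a
    0<b+a = proj₂ both
    -- Doubling gives 2 φ⁺ - 2 x φ = (b - a - 1)(x φ + ψ) + (b + a - 1)(x φ - ψ). The scalars are
    -- nonnegative because b - a and b + a are positive integers, so φ⁺ inherits the strict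
    -- positivity of x φ.
    X≤ : ∀ j → X j ≤ tcoef j φ⁺
    X≤ j = ℤ.*-cancelˡ-≤-pos (X j) (tcoef j φ⁺) (+ 2) (ℤ.0≤i-j⇒j≤i (subst (+ 0 ≤_) eq
        (0≤-sum (0≤-product (pred-nonneg 0<b-a) (proj₁ (0≤X±ψ j))) (0≤-product (pred-nonneg 0<b+a) (proj₂ (0≤X±ψ j))))))
      where
      pred-nonneg : ∀ {i} → + 0 < i → + 0 ≤ i - + 1
      pred-nonneg h = ℤ.i≤j⇒0≤j-i (ℤ.i<j⇒suc[i]≤j h)
      lem₃ : ∀ a b x y → (b - a - + 1) * (x + y) + (b + a - + 1) * (x - y) ≡ + 2 * (b * x - a * y) - + 2 * x
      lem₃ = solve-∀
      eq : (b - a - + 1) * (X j + tcoef j ψₖ) + (b + a - + 1) * (X j - tcoef j ψₖ) ≡ + 2 * tcoef j φ⁺ - + 2 * X j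
      eq = trans (lem₃ a b (X j) (tcoef j ψₖ)) (cong (λ t → + 2 * t - + 2 * X j) (sym (tcoef-φ⁺ j)))

-- Positive definiteness, and the kernel at the end of the recursion

PositiveDefinite : (ℤ → ℤ) → ℕ → Set
PositiveDefinite c N = ∀ p → length p ℕ.≤ N → IsZero p ⊎ + 0 < dot p (act p c) 0

leading-nonzero : ∀ {ℓ k p} → + 0 < ℓ → Leading ℓ k p → ¬ IsZero p
leading-nonzero 0<ℓ top (refl ∷ []) = ℤ.<-irrefl refl 0<ℓ
leading-nonzero 0<ℓ (cons a l) (_ ∷ z) = leading-nonzero 0<ℓ l z

-- Orthogonality removes every term of the form at p except the top one, leaving ℓ times the pairing
-- with x^k.
norm-positive : ∀ {c N ℓ k p} → PositiveDefinite c N → Leading ℓ k p → k ℕ.< N → + 0 < ℓ →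
  (∀ i → i ℕ.< k → act p c (+ i) ≡ + 0) → + 0 < act p c (+ k)
norm-positive {c} {p = p} pd l k<N 0<ℓ orth with pd p (subst (ℕ._≤ _) (sym (leading-length l)) k<N)
... | inj₁ z = ⊥-elim (leading-nonzero 0<ℓ l z)
... | inj₂ h = 0<-factor 0<ℓ (subst (+ 0 <_) (dot-leading (act p c) 0 l orth) h)

szegő : ∀ {c N} → (∀ i → c (- i) ≡ c i) → PositiveDefinite c N → ∀ k → k ℕ.< N → Szegő c k
szegő {c} even pd zero 0<N = record
  { φₖ = + 1 ∷ [] ; ψₖ = + 1 ∷ [] ; ℓ = + 1 ; leading = top ; 0<ℓ = +<+ (s≤s z≤n) ; length-ψ = ℕ.≤-refl
  ; reversal = λ i → cong (λ z → + 1 * z + + 0) (trans (sym (even i)) (cong c (sym (ℤ.+-identityˡ (- i)))))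
  ; orthogonal = λ i () ; 0<norm = norm-positive {c} {ℓ = + 1} pd top 0<N (+<+ (s≤s z≤n)) (λ i ())
  ; bound⁺ = λ { zero → +≤+ z≤n ; (suc zero) → +≤+ z≤n ; (suc (suc j)) → +≤+ z≤n }
  ; bound⁻ = λ { zero → +≤+ z≤n ; (suc zero) → +≤+ z≤n ; (suc (suc j)) → +≤+ z≤n }
  ; 0≤tcoef = λ { zero → +≤+ z≤n ; (suc j) → +≤+ z≤n }
  ; 0<tcoef = λ { zero _ → +<+ (s≤s z≤n) } }
szegő {c} even pd (suc k) k<N = next (norm-positive {c} pd leading⁺ k<N 0<ℓ⁺ orthogonal⁺)
  where open Step (szegő even pd k (ℕ.<-trans (ℕ.n<1+n k) k<N))

-- One further step from degree N - 1 gives φ⁺ of degree N. Subtracting b ℓ f leaves g with at most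
-- N coefficients; as f is in the kernel, g pairs like φ⁺ and is orthogonal to all lower powers. Its
-- form value is 0, so g = 0 and φ⁺ = b ℓ f.
kernel-tcoef-positive : ∀ {c N f} → (∀ i → c (- i) ≡ c i) → PositiveDefinite c N →
  Monic N f → (∀ i → act f c i ≡ + 0) → ∀ j → suc j ℕ.≤ N → + 0 < tcoef (suc j) f
kernel-tcoef-positive {c} {suc k} {f} even pd mf ker j (s≤s j≤k) = 0<-factor 0<ℓ⁺ (subst (+ 0 <_) tcoef-φ⁺≡ 0<φ⁺)
  where
  S = szegő {c} even pd k ℕ.≤-refl
  open Szegő S
  open Step S
  g = proj₁ (cancel-leading leading⁺ mf)
  length-g = proj₁ (proj₂ (cancel-leading leading⁺ mf))
  act-g = proj₁ (proj₂ (proj₂ (cancel-leading leading⁺ mf)))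
  tcoef-g = proj₂ (proj₂ (proj₂ (cancel-leading leading⁺ mf)))
  act-g≡ : ∀ i → act g c i ≡ act φ⁺ c i
  act-g≡ i = trans (act-g c i) (trans (cong (λ z → act φ⁺ c i - b * ℓ * z) (ker i)) (lem (act φ⁺ c i) (b * ℓ)))
    where
    lem : ∀ u v → u - v * + 0 ≡ u
    lem = solve-∀
  g-zero : IsZero g
  g-zero with pd g (ℕ.≤-reflexive length-g)
  ... | inj₁ z = z
  ... | inj₂ h = ⊥-elim (ℤ.<-irrefl refl (subst (+ 0 <_)
    (dot-zero g (act g c) 0 (λ i i<g → trans (act-g≡ (+ i)) (orthogonal⁺ i (subst (i ℕ.<_) length-g i<g)))) h))
  tcoef-φ⁺≡ : tcoef (suc j) φ⁺ ≡ b * ℓ * tcoef (suc j) f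
  tcoef-φ⁺≡ = ℤ.i-j≡0⇒i≡j _ _ (trans (sym (tcoef-g (suc j))) (tcoef-zero g-zero (suc j)))
  norm-zero : (b - a) * (b + a) ≡ + 0
  norm-zero = trans (sym norm⁺) (trans (sym (act-g≡ (+ suc k))) (act-zero g-zero c (+ suc k)))
  0<φ⁺ : + 0 < tcoef (suc j) φ⁺
  -- The vanishing norm leaves a = b or a = -b, so φ⁺ is b (x φ - ψ) or b (x φ + ψ), both covered by
  -- `0<X±ψ`.
  0<φ⁺ with ℤ.i*j≡0⇒i≡0∨j≡0 (b - a) norm-zero
  ... | inj₁ e = subst (+ 0 <_) (sym (trans (tcoef-φ⁺ (suc j)) eq)) (0<-product 0<norm (proj₂ (0<X±ψ j j≤k)))
    where
    lem : ∀ a b x y → b * x - a * y ≡ b * (x - y) + (b - a) * y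
    lem = solve-∀
    eq : b * X (suc j) - a * tcoef (suc j) ψₖ ≡ b * (X (suc j) - tcoef (suc j) ψₖ)
    eq = trans (lem a b _ _) (trans (cong (λ z → b * (X (suc j) - tcoef (suc j) ψₖ) + z * tcoef (suc j) ψₖ) e) (ℤ.+-identityʳ _))
  ... | inj₂ e = subst (+ 0 <_) (sym (trans (tcoef-φ⁺ (suc j)) eq)) (0<-product 0<norm (proj₁ (0<X±ψ j j≤k)))
    where
    lem : ∀ a b x y → b * x - a * y ≡ b * (x + y) + (b + a) * (- y)
    lem = solve-∀
    eq : b * X (suc j) - a * tcoef (suc j) ψₖ ≡ b * (X (suc j) + tcoef (suc j) ψₖ)
    eq = trans (lem a b _ _) (trans (cong (λ z → b * (X (suc j) + tcoef (suc j) ψₖ) + z * (- tcoef (suc j) ψₖ)) e) (ℤ.+-identityʳ _))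

-- Sums over a period

sumTo : ℕ → (ℤ → ℤ) → ℤ
sumTo zero u = + 0
sumTo (suc k) u = sumTo k u + u (+ k)

sumTo-cong : ∀ k {u v} → (∀ m → u m ≡ v m) → sumTo k u ≡ sumTo k v
sumTo-cong zero h = refl
sumTo-cong (suc k) h = cong₂ _+_ (sumTo-cong k h) (h (+ k))

sumTo-+ : ∀ k u v → sumTo k (λ m → u m + v m) ≡ sumTo k u + sumTo k v
sumTo-+ zero u v = refl
sumTo-+ (suc k) u v rewrite sumTo-+ k u v = lem (sumTo k u) (sumTo k v) (u (+ k)) (v (+ k))
  where
  lem : ∀ a b x y → a + b + (x + y) ≡ a + x + (b + y)
  lem = solve-∀

sumTo-* : ∀ k a u → sumTo k (λ m → a * u m) ≡ a * sumTo k u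
sumTo-* zero a u = sym (ℤ.*-zeroʳ a)
sumTo-* (suc k) a u rewrite sumTo-* k a u = sym (ℤ.*-distribˡ-+ a (sumTo k u) (u (+ k)))

sumTo-zero : ∀ k → sumTo k (λ _ → + 0) ≡ + 0
sumTo-zero zero = refl
sumTo-zero (suc k) rewrite sumTo-zero k = refl

Periodic : ℕ → (ℤ → ℤ) → Set
Periodic n u = ∀ m → u (m + + n) ≡ u m

periodic-shift : ∀ {n u} i → Periodic n u → Periodic n (λ m → u (m + i))
periodic-shift {n} {u} i h m = trans (cong u (lem m (+ n) i)) (h (m + i))
  where
  lem : ∀ m n i → m + n + i ≡ m + i + n
  lem = solve-∀

periodic-* : ∀ {n u v} → Periodic n u → Periodic n v → Periodic n (λ m → u m * v m)
periodic-* hu hv m = cong₂ _*_ (hu m) (hv m)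

-- The shifted sum plus u(0) telescopes to the sum plus u(n), and u(n) = u(0).
sumTo-suc : ∀ {n u} → Periodic n u → sumTo n (λ m → u (m + + 1)) ≡ sumTo n u
sumTo-suc {n} {u} h = ∙-cancelʳ _ _ _ (trans (telescope n) (cong (_+_ (sumTo n u)) (trans (cong u (sym (ℤ.+-identityˡ (+ n)))) (h (+ 0)))))
  where
  lem : ∀ a b c → a + b + c ≡ a + c + b
  lem = solve-∀
  telescope : ∀ k → sumTo k (λ m → u (m + + 1)) + u (+ 0) ≡ sumTo k u + u (+ k)
  telescope zero = refl
  telescope (suc k) = trans (lem (sumTo k _) (u (+ k + + 1)) (u (+ 0)))
    (cong₂ _+_ (telescope k) (cong (λ z → u (+ z)) (ℕ.+-comm k 1)))

sumTo-shift⁺ : ∀ {n u} i → Periodic n u → sumTo n (λ m → u (m + + i)) ≡ sumTo n u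
sumTo-shift⁺ {n} {u} zero h = sumTo-cong n (λ m → cong u (ℤ.+-identityʳ m))
sumTo-shift⁺ {n} {u} (suc i) h = trans (sumTo-cong n (λ m → cong u (lem m (+ i))))
    (trans (sumTo-suc (periodic-shift {u = u} (+ i) h)) (sumTo-shift⁺ {u = u} i h))
  where
  lem : ∀ m i → m + (+ 1 + i) ≡ m + + 1 + i
  lem = solve-∀

sumTo-shift : ∀ {n u} i → Periodic n u → sumTo n (λ m → u (m + i)) ≡ sumTo n u
sumTo-shift {n} {u} (+ i) h = sumTo-shift⁺ {u = u} i h
sumTo-shift {n} {u} i@(-[1+ j ]) h = trans
    (sym (sumTo-shift⁺ {u = λ m → u (m + i)} (suc j) (periodic-shift {u = u} i h)))
    (sumTo-cong n (λ m → cong u (lem m (+ suc j))))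
  where
  lem : ∀ m j → m + j + - j ≡ m
  lem = solve-∀

sum-of-squares : ∀ k (u : ℤ → ℤ) → (∀ j → j ℕ.< k → u (+ j) ≡ + 0) ⊎ + 0 < sumTo k (λ m → u m * u m)
sum-of-squares zero u = inj₁ (λ j ())
sum-of-squares (suc k) u = combine (sum-of-squares k u) (square (u (+ k)))
  where
  square : ∀ a → a ≡ + 0 ⊎ + 0 < a * a
  square (+ zero) = inj₁ refl
  square (+ suc a) = inj₂ (+<+ (s≤s z≤n))
  square -[1+ a ] = inj₂ (+<+ (s≤s z≤n))
  0≤square : ∀ {a} → a ≡ + 0 ⊎ + 0 < a * a → + 0 ≤ a * a
  0≤square (inj₁ refl) = ℤ.≤-refl
  0≤square (inj₂ h) = ℤ.<⇒≤ h
  0≤sum : ∀ k → + 0 ≤ sumTo k (λ m → u m * u m)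
  0≤sum zero = ℤ.≤-refl
  0≤sum (suc k) = 0≤-sum (0≤sum k) (0≤square {u (+ k)} (square (u (+ k))))
  combine : (∀ j → j ℕ.< k → u (+ j) ≡ + 0) ⊎ + 0 < sumTo k (λ m → u m * u m) → u (+ k) ≡ + 0 ⊎ + 0 < u (+ k) * u (+ k) →
    (∀ j → j ℕ.< suc k → u (+ j) ≡ + 0) ⊎ + 0 < sumTo (suc k) (λ m → u m * u m)
  combine _ (inj₂ h) = inj₂ (0<-sum (0≤sum k) h)
  combine (inj₂ h) s = inj₂ (ℤ.+-mono-<-≤ h (0≤square {u (+ k)} s))
  combine (inj₁ z) (inj₁ e) = inj₁ λ j j<sk → case-≤ j (ℕ.m≤n⇒m<n∨m≡n (ℕ.≤-pred j<sk))
    where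
    case-≤ : ∀ j → j ℕ.< k ⊎ j ≡ k → u (+ j) ≡ + 0
    case-≤ j (inj₁ j<k) = z j j<k
    case-≤ j (inj₂ refl) = e

-- The autocorrelation of a periodic sequence

correlation : ℕ → (ℤ → ℤ) → (ℤ → ℤ) → ℤ → ℤ
correlation n u v i = sumTo n (λ k → u k * v (k + i))

correlation-even : ∀ {n u} → Periodic n u → ∀ i → correlation n u u (- i) ≡ correlation n u u i
correlation-even {n} {u} h i = trans
    (sym (sumTo-shift {u = λ k → u k * u (k + - i)} i (periodic-* {u = u} h (periodic-shift {u = u} (- i) h))))
    (sumTo-cong n (λ k → trans (ℤ.*-comm (u (k + i)) _) (cong (λ z → u z * u (k + i)) (lem k i))))
  where
  lem : ∀ k i → k + i + - i ≡ k
  lem = solve-∀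

act-correlation : ∀ n u v p i → act p (correlation n u v) i ≡ correlation n u (act p v) i
act-correlation n u v [] i = sym (trans (sumTo-cong n (λ k → ℤ.*-zeroʳ (u k))) (sumTo-zero n))
act-correlation n u v (a ∷ p) i = begin
  a * correlation n u v i + act p (correlation n u v) (i - + 1)
    ≡⟨ cong₂ _+_ (sym (sumTo-* n a _)) (act-correlation n u v p (i - + 1)) ⟩
  sumTo n (λ k → a * (u k * v (k + i))) + sumTo n (λ k → u k * act p v (k + (i - + 1)))
    ≡⟨ sym (sumTo-+ n _ _) ⟩
  sumTo n (λ k → a * (u k * v (k + i)) + u k * act p v (k + (i - + 1)))
    ≡⟨ sumTo-cong n (λ k → trans (cong (λ z → a * (u k * v (k + i)) + u k * act p v z) (sym (ℤ.+-assoc k i (- + 1))))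
         (lem a (u k) (v (k + i)) (act p v (k + i - + 1)))) ⟩
  correlation n u (act (a ∷ p) v) i ∎
  where
  open ≡-Reasoning
  lem : ∀ a x y z → a * (x * y) + x * z ≡ x * (a * y + z)
  lem = solve-∀

-- Shift invariance moves p onto the first sequence, as `act-correlation` moves it onto the second.
-- Together they turn the Toeplitz form of an autocorrelation into a sum of squares.
dot-correlation : ∀ {n u v} → Periodic n u → Periodic n v → ∀ p i →
  dot p (correlation n u v) i ≡ sumTo n (λ k → act p u (k - + i) * v k)
dot-correlation {n} hu hv [] i = sym (sumTo-zero n)
dot-correlation {n} {u} {v} hu hv (a ∷ p) i = begin
  a * correlation n u v (+ i) + dot p (correlation n u v) (suc i)
    ≡⟨ cong₂ (λ y z → a * y + z) moved (dot-correlation hu hv p (suc i)) ⟩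
  a * sumTo n (λ k → u (k - + i) * v k) + sumTo n (λ k → act p u (k - + suc i) * v k)
    ≡⟨ cong (_+ sumTo n (λ k → act p u (k - + suc i) * v k)) (sym (sumTo-* n a _)) ⟩
  sumTo n (λ k → a * (u (k - + i) * v k)) + sumTo n (λ k → act p u (k - + suc i) * v k)
    ≡⟨ sym (sumTo-+ n _ _) ⟩
  sumTo n (λ k → a * (u (k - + i) * v k) + act p u (k - + suc i) * v k)
    ≡⟨ sumTo-cong n (λ k → trans (cong (λ z → a * (u (k - + i) * v k) + act p u z * v k) (lem k (+ i)))
         (lem₂ a (u (k - + i)) (v k) (act p u (k - + i - + 1)))) ⟩
  sumTo n (λ k → act (a ∷ p) u (k - + i) * v k) ∎
  where
  open ≡-Reasoning
  lem : ∀ k i → k - (+ 1 + i) ≡ k - i - + 1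
  lem = solve-∀
  lem₂ : ∀ a x y z → a * (x * y) + z * y ≡ (a * x + z) * y
  lem₂ = solve-∀
  lem₃ : ∀ k i → k - i + i ≡ k
  lem₃ = solve-∀
  moved : correlation n u v (+ i) ≡ sumTo n (λ k → u (k - + i) * v k)
  moved = trans
    (sym (sumTo-shift {u = λ k → u k * v (k + + i)} (- + i) (periodic-* {u = u} hu (periodic-shift {u = v} (+ i) hv))))
    (sumTo-cong n (λ k → cong (λ z → u (k - + i) * v z) (lem₃ k (+ i))))

-- Polynomials modulo x ^ n - 1 as periodic sequences

count : ∀ {P : Set} → Dec P → ℕ
count (yes _) = 1
count (no _)  = 0

count-cong : ∀ {P Q : Set} (P? : Dec P) (Q? : Dec Q) → (P → Q) → (Q → P) → count P? ≡ count Q?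
count-cong (yes _) (yes _) f g = refl
count-cong (yes p) (no ¬q) f g = ⊥-elim (¬q (f p))
count-cong (no ¬p) (yes q) f g = ⊥-elim (¬p (g q))
count-cong (no _)  (no _)  f g = refl

-- The class of 1 modulo xⁿ - 1; `act p (δ n)` is the periodic sequence of coefficients of p reduced
-- modulo xⁿ - 1.
δ : ℕ → ℤ → ℤ
δ n m = + count (n ∣? ∣ m ∣)

δ-periodic : ∀ n → Periodic n (δ n)
δ-periodic n m = cong +_ (count-cong _ _
  (λ d → ∣⇒∣ᵤ {+ n} {m} (∣m+n∣m⇒∣n (subst (+ n ∣ᶻ_) (ℤ.+-comm m (+ n)) (∣ᵤ⇒∣ {+ n} {m + + n} d)) ∣-refl))
  (λ d → ∣⇒∣ᵤ {+ n} {m + + n} (∣m∣n⇒∣m+n (∣ᵤ⇒∣ {+ n} {m} d) ∣-refl)))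

-- Index -(j + 1) is n - (j + 1) modulo n, which lies at or beyond the end of p.
act-δ-negative : ∀ {n} p j → suc j ℕ.+ length p ℕ.≤ n → act p (δ n) -[1+ j ] ≡ + 0
act-δ-negative [] j l = refl
act-δ-negative {n} (a ∷ p) j l with n ∣? suc j
... | yes d = ⊥-elim (ℕ.<⇒≱ (ℕ.≤-trans (ℕ.m<m+n (suc j) (s≤s z≤n)) l) (ℕ.∣⇒≤ d))
... | no _ rewrite ℕ.+-identityʳ j = trans (cong (_+ act p (δ n) -[1+ suc j ]) (ℤ.*-zeroʳ a))
        (trans (ℤ.+-identityˡ _) (act-δ-negative p (suc j) (subst (ℕ._≤ n) (ℕ.+-suc (suc j) (length p)) l)))

-- With at most n coefficients nothing wraps around: the value at 0 is the constant term, and once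
-- that is 0 the later values are those of the tail. The bound L shrinks along the list while the
-- period n stays fixed.
act-δ-injective : ∀ {n} p L → length p ℕ.≤ L → L ℕ.≤ n → (∀ k → k ℕ.< L → act p (δ n) (+ k) ≡ + 0) → IsZero p
act-δ-injective [] L l l′ h = []
act-δ-injective {n} (a ∷ p) (suc L) (s≤s l) l′ h = a≡0 ∷
    act-δ-injective p L l (ℕ.≤-trans (ℕ.n≤1+n L) l′) (λ k k<L →
      trans (sym (trans (cong (λ z → z * δ n (+ suc k) + act p (δ n) (+ k)) a≡0) (ℤ.+-identityˡ _))) (h (suc k) (s≤s k<L)))
  where
  δ0 : δ n (+ 0) ≡ + 1
  δ0 with n ∣? 0
  ... | yes _ = refl
  ... | no ¬d = ⊥-elim (¬d (n ℕ.∣0))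
  lem : ∀ a → a ≡ a * + 1 + + 0
  lem = solve-∀
  a≡0 : a ≡ + 0
  a≡0 = trans (lem a) (trans (sym (cong₂ (λ y z → a * y + z) δ0 (act-δ-negative p 0 (ℕ.≤-trans (s≤s l) l′)))) (h 0 (s≤s z≤n)))

act-replicate-0 : ∀ k q u m → act (replicate k (+ 0) ++ q) u m ≡ act q u (m - + k)
act-replicate-0 zero q u m = cong (act q u) (sym (ℤ.+-identityʳ m))
act-replicate-0 (suc k) q u m = trans (act-shift (replicate k (+ 0) ++ q) u m) (trans (act-replicate-0 k q u (m - + 1)) (cong (act q u) (lem m (+ k))))
  where
  lem : ∀ m k → m - + 1 - k ≡ m - (+ 1 + k)
  lem = solve-∀

act-xnm1 : ∀ n {u} → Periodic (suc n) u → ∀ m → act (xnm1 (suc n)) u m ≡ + 0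
act-xnm1 n {u} h m = begin
  - + 1 * u m + act (replicate n (+ 0) ++ + 1 ∷ []) u (m - + 1)
    ≡⟨ cong (_+_ (- + 1 * u m)) (act-replicate-0 n (+ 1 ∷ []) u (m - + 1)) ⟩
  - + 1 * u m + (+ 1 * u (m - + 1 - + n) + + 0)
    ≡⟨ cong (λ z → - + 1 * u m + (+ 1 * z + + 0)) (trans (sym (h (m - + 1 - + n))) (cong u (lem m (+ n)))) ⟩
  - + 1 * u m + (+ 1 * u m + + 0) ≡⟨ lem₂ (u m) ⟩
  + 0 ∎
  where
  open ≡-Reasoning
  lem : ∀ m n → m - + 1 - n + (+ 1 + n) ≡ m
  lem = solve-∀
  lem₂ : ∀ a → - + 1 * a + (+ 1 * a + + 0) ≡ + 0
  lem₂ = solve-∀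

length-pmul : ∀ {k m h} p → Monic m h → length p ℕ.≤ k → length (pmul p h) ℕ.≤ k ℕ.+ m
length-pmul [] mh l = z≤n
length-pmul {suc k} {m} {h} (a ∷ p) mh (s≤s l) = length-padd (scale a h) _
  (length-scale a h (subst (ℕ._≤ suc k ℕ.+ m) (sym (leading-length mh)) (s≤s (ℕ.m≤n+m m k))))
  (s≤s (length-pmul p mh l))

-- f annihilates c because f h = xⁿ - 1 annihilates periodic sequences. The form at p is the sum of
-- squared coefficients of p h modulo xⁿ - 1, so it vanishes only if p h does.
divisor-tcoef-positive : ∀ {N M n f h} → Monic N f → Monic M h → N ℕ.+ M ≡ suc n →
  (∀ x → evalℤ f x * evalℤ h x ≡ evalℤ (xnm1 (suc n)) x) → ∀ j → suc j ℕ.≤ N → + 0 < tcoef (suc j) f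
divisor-tcoef-positive {N} {M} {n} {f} {h} mf mh deg fh = kernel-tcoef-positive {c} (correlation-even {u = ĥ} periodic) pd mf ker
  where
  ĥ c : ℤ → ℤ
  ĥ = act h (δ (suc n))
  c = correlation (suc n) ĥ ĥ
  periodic : Periodic (suc n) ĥ
  periodic = act-translate h (δ (suc n)) (+ suc n) (δ-periodic (suc n))
  ker : ∀ i → act f c i ≡ + 0
  ker i = trans (act-correlation (suc n) ĥ ĥ f i) (trans (sumTo-cong (suc n) (λ k → trans (cong (ĥ k *_) (fĥ (k + i))) (ℤ.*-zeroʳ (ĥ k)))) (sumTo-zero (suc n)))
    where
    fĥ : ∀ m → act f ĥ m ≡ + 0
    fĥ m = trans (sym (act-pmul f h (δ (suc n)) m))
      (trans (act-≈ (pmul f h) (xnm1 (suc n)) (λ x → trans (eval-pmul f h x) (fh x)) (δ (suc n)) m)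
             (act-xnm1 n {δ (suc n)} (δ-periodic (suc n)) m))
  norm : ∀ p → dot p (act p c) 0 ≡ sumTo (suc n) (λ k → act p ĥ k * act p ĥ k)
  norm p = trans (dot-cong p 0 (act-correlation (suc n) ĥ ĥ p))
    (trans (dot-correlation {u = ĥ} {v = act p ĥ} periodic (act-translate p ĥ (+ suc n) periodic) p 0)
      (sumTo-cong (suc n) (λ k → cong (λ z → act p ĥ z * act p ĥ k) (ℤ.+-identityʳ k))))
    where
    dot-cong : ∀ p i {u v} → (∀ m → u m ≡ v m) → dot p u i ≡ dot p v i
    dot-cong [] i h = refl
    dot-cong (a ∷ p) i h = cong₂ (λ y z → a * y + z) (h (+ i)) (dot-cong p (suc i) h)
  pd : PositiveDefinite c N
  pd p l with sum-of-squares (suc n) (act p ĥ)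
  ... | inj₂ pos = inj₂ (subst (+ 0 <_) (sym (norm p)) pos)
  ... | inj₁ z = inj₁ (monic-cancel p mh (λ x → trans (ℤ.*-comm (evalℤ h x) _) (trans (sym (eval-pmul p h x)) (eval-zero ph-zero x))))
    where
    ph-zero : IsZero (pmul p h)
    -- p h has at most N + M = n coefficients, so vanishing modulo xⁿ - 1 is vanishing outright.
    -- This is where the bound N on the length of p enters.
    ph-zero = act-δ-injective (pmul p h) (suc n) (subst (length (pmul p h) ℕ.≤_) deg (length-pmul p mh l)) ℕ.≤-refl
      (λ k k<n → trans (act-pmul p h (δ (suc n)) (+ k)) (z k k<n))

-- Taylor coefficients of derivatives

tcoef-derivAux : ∀ j i p → tcoef j (derivAux (suc i) p) ≡ tcoef j (derivAux i p) + tcoef j p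
tcoef-derivAux j i [] = refl
tcoef-derivAux zero i (a ∷ p) rewrite tcoef-derivAux zero (suc i) p = lem (+ i) a (tcoef 0 (derivAux (suc i) p)) (tcoef 0 p)
  where
  lem : ∀ i a u v → (+ 1 + i) * a + (u + v) ≡ i * a + u + (a + v)
  lem = solve-∀
tcoef-derivAux (suc j) i (a ∷ p) rewrite tcoef-derivAux (suc j) (suc i) p | tcoef-derivAux j (suc i) p
  = lem (tcoef (suc j) (derivAux (suc i) p)) (tcoef (suc j) p) (tcoef j (derivAux (suc i) p)) (tcoef j p)
  where
  lem : ∀ u v w z → u + v + (w + z) ≡ u + w + (v + z)
  lem = solve-∀

-- `derivAux i p` represents i p + x p′, so the derivative of a + x p is `derivAux 1 p`. Splitting p
-- as b ∷ q lets `derivAux 0 p` unfold to x times `deriv p`, which gives the recursion.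
tcoef-deriv : ∀ j p → tcoef j (deriv p) ≡ + suc j * tcoef (suc j) p
tcoef-deriv j [] = sym (ℤ.*-zeroʳ (+ suc j))
tcoef-deriv j (a ∷ []) = sym (ℤ.*-zeroʳ (+ suc j))
tcoef-deriv zero (a ∷ p@(b ∷ q)) = trans (tcoef-derivAux 0 0 p)
  (trans (cong (λ t → + 0 + t + tcoef 0 p) (tcoef-deriv 0 p)) (lem (tcoef 1 p) (tcoef 0 p)))
  where
  lem : ∀ u v → + 0 + + 1 * u + v ≡ + 1 * (u + v)
  lem = solve-∀
tcoef-deriv (suc j) (a ∷ p@(b ∷ q)) = trans (tcoef-derivAux (suc j) 0 p)
  (trans (cong₂ (λ s t → s + t + tcoef (suc j) p) (tcoef-deriv (suc j) p) (tcoef-deriv j p)) (lem (+ suc j) (tcoef (suc (suc j)) p) (tcoef (suc j) p)))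
  where
  lem : ∀ j u v → (+ 1 + j) * u + j * v + v ≡ (+ 1 + j) * (u + v)
  lem = solve-∀

-- The factor m + 1 is (k + j)! / j!, of which only the positivity is used.
tcoef-derivN : ∀ k j p → ∃ λ m → tcoef j (derivN k p) ≡ + suc m * tcoef (k ℕ.+ j) p
tcoef-derivN zero j p = 0 , sym (ℤ.*-identityˡ _)
tcoef-derivN (suc k) j p with tcoef-derivN k j (deriv p)
... | m , eq = k ℕ.+ j ℕ.+ m ℕ.* suc (k ℕ.+ j) , trans eq (trans (cong (+ suc m *_) (tcoef-deriv (k ℕ.+ j) p))
    (trans (sym (ℤ.*-assoc (+ suc m) (+ suc (k ℕ.+ j)) _)) (cong (_* tcoef (suc (k ℕ.+ j)) p) (sym (ℤ.pos-* (suc m) (suc (k ℕ.+ j)))))))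

evalℤ-1 : ∀ p → evalℤ p (+ 1) ≡ tcoef 0 p
evalℤ-1 [] = refl
evalℤ-1 (a ∷ p) = cong (_+_ a) (trans (ℤ.*-identityˡ _) (evalℤ-1 p))

derivN-positive : ∀ k j p → + 0 < tcoef (k ℕ.+ j) p → + 0 < tcoef j (derivN k p)
derivN-positive k j p h with tcoef-derivN k j p
... | m , eq = subst (+ 0 <_) (sym eq) (0<-product {+ suc m} (+<+ (s≤s z≤n)) h)

derivN-nonneg : ∀ k j p → + 0 ≤ tcoef (k ℕ.+ j) p → + 0 ≤ tcoef j (derivN k p)
derivN-nonneg k j p h with tcoef-derivN k j p
... | m , eq = subst (+ 0 ≤_) (sym eq) (0≤-product {+ suc m} (+≤+ z≤n) h)

-- Monotonicity from Taylor coefficients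

fromℤ : ℤ → ℚ
fromℤ a = a ℚ./ 1

fromℤ-+ : ∀ a b → fromℤ (a + b) ≡ fromℤ a ℚ.+ fromℤ b
fromℤ-+ a b = ℚ.toℚᵘ-injective (begin
  ℚ.toℚᵘ (fromℤ (a + b))                   ≈⟨ ℚ.toℚᵘ-fromℚᵘ (ℚᵘ.mkℚᵘ (a + b) 0) ⟩
  ℚᵘ.mkℚᵘ (a + b) 0                        ≈⟨ ℚᵘ.*≡* (cong (_* + 1) (cong₂ _+_ (sym (ℤ.*-identityʳ a)) (sym (ℤ.*-identityʳ b)))) ⟩
  ℚᵘ.mkℚᵘ a 0 ℚᵘ.+ ℚᵘ.mkℚᵘ b 0             ≈⟨ ℚᵘ.+-cong (ℚᵘ.≃-sym (ℚ.toℚᵘ-fromℚᵘ (ℚᵘ.mkℚᵘ a 0))) (ℚᵘ.≃-sym (ℚ.toℚᵘ-fromℚᵘ (ℚᵘ.mkℚᵘ b 0))) ⟩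
  ℚ.toℚᵘ (fromℤ a) ℚᵘ.+ ℚ.toℚᵘ (fromℤ b)   ≈⟨ ℚᵘ.≃-sym (ℚ.toℚᵘ-homo-+ (fromℤ a) (fromℤ b)) ⟩
  ℚ.toℚᵘ (fromℤ a ℚ.+ fromℤ b)             ∎)
  where open ℚᵘ.≃-Reasoning

fromℤ-nonneg : ∀ {a} → + 0 ≤ a → 0ℚ ℚ.≤ fromℤ a
fromℤ-nonneg {a} h = ℚ.toℚᵘ-cancel-≤ (ℚᵘ.≤-respʳ-≃ (ℚᵘ.≃-sym (ℚ.toℚᵘ-fromℚᵘ (ℚᵘ.mkℚᵘ a 0)))
  (ℚᵘ.*≤* (subst (+ 0 ≤_) (sym (ℤ.*-identityʳ a)) h)))

fromℤ-positive : ∀ {a} → + 0 < a → 0ℚ ℚ.< fromℤ a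
fromℤ-positive {a} h = ℚ.toℚᵘ-cancel-< (ℚᵘ.<-respʳ-≃ (ℚᵘ.≃-sym (ℚ.toℚᵘ-fromℚᵘ (ℚᵘ.mkℚᵘ a 0)))
  (ℚᵘ.*<* (subst (+ 0 <_) (sym (ℤ.*-identityʳ a)) h)))

-- The list of all `tcoef j p`, formed so that p can be evaluated in y = x - 1 ≥ 0.
taylor : Poly → Poly
taylor [] = []
taylor (a ∷ p) = padd (a ∷ taylor p) (taylor p)

coef : Poly → ℕ → ℤ
coef [] j = + 0
coef (a ∷ p) zero = a
coef (a ∷ p) (suc j) = coef p j

coef-padd : ∀ p q j → coef (padd p q) j ≡ coef p j + coef q j
coef-padd [] q j = sym (ℤ.+-identityˡ _)
coef-padd (a ∷ p) [] j = sym (ℤ.+-identityʳ _)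
coef-padd (a ∷ p) (b ∷ q) zero = refl
coef-padd (a ∷ p) (b ∷ q) (suc j) = coef-padd p q j

coef-taylor : ∀ p j → coef (taylor p) j ≡ tcoef j p
coef-taylor [] j = refl
coef-taylor (a ∷ p) zero = trans (coef-padd (a ∷ taylor p) (taylor p) 0) (cong (_+_ a) (coef-taylor p 0))
coef-taylor (a ∷ p) (suc j) = trans (coef-padd (a ∷ taylor p) (taylor p) (suc j))
  (trans (cong₂ _+_ (coef-taylor p j) (coef-taylor p (suc j))) (ℤ.+-comm (tcoef j p) (tcoef (suc j) p)))

private
  interchange : ∀ a b c d → a ℚ.+ b ℚ.+ (c ℚ.+ d) ≡ a ℚ.+ c ℚ.+ (b ℚ.+ d)
  interchange a b c d = begin
    a ℚ.+ b ℚ.+ (c ℚ.+ d)   ≡⟨ ℚ.+-assoc a b (c ℚ.+ d) ⟩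
    a ℚ.+ (b ℚ.+ (c ℚ.+ d)) ≡⟨ cong (a ℚ.+_) (trans (sym (ℚ.+-assoc b c d)) (trans (cong (ℚ._+ d) (ℚ.+-comm b c)) (ℚ.+-assoc c b d))) ⟩
    a ℚ.+ (c ℚ.+ (b ℚ.+ d)) ≡⟨ sym (ℚ.+-assoc a c (b ℚ.+ d)) ⟩
    a ℚ.+ c ℚ.+ (b ℚ.+ d)   ∎
    where open ≡-Reasoning

evalℚ-padd : ∀ p q x → evalℚ (padd p q) x ≡ evalℚ p x ℚ.+ evalℚ q x
evalℚ-padd [] q x = sym (ℚ.+-identityˡ _)
evalℚ-padd (a ∷ p) [] x = sym (ℚ.+-identityʳ _)
evalℚ-padd (a ∷ p) (b ∷ q) x = trans
  (cong₂ ℚ._+_ (fromℤ-+ a b) (trans (cong (x ℚ.*_) (evalℚ-padd p q x)) (ℚ.*-distribˡ-+ x (evalℚ p x) (evalℚ q x))))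
  (interchange (fromℤ a) (fromℤ b) (x ℚ.* evalℚ p x) (x ℚ.* evalℚ q x))

evalℚ-taylor : ∀ p s → evalℚ p (1ℚ ℚ.+ s) ≡ evalℚ (taylor p) s
evalℚ-taylor [] s = refl
evalℚ-taylor (a ∷ p) s = begin
  fromℤ a ℚ.+ (1ℚ ℚ.+ s) ℚ.* evalℚ p (1ℚ ℚ.+ s) ≡⟨ cong (λ e → fromℤ a ℚ.+ (1ℚ ℚ.+ s) ℚ.* e) (evalℚ-taylor p s) ⟩
  fromℤ a ℚ.+ (1ℚ ℚ.+ s) ℚ.* t                  ≡⟨ cong (fromℤ a ℚ.+_) (trans (ℚ.*-distribʳ-+ t 1ℚ s) (trans (cong (ℚ._+ s ℚ.* t) (ℚ.*-identityˡ t)) (ℚ.+-comm t (s ℚ.* t)))) ⟩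
  fromℤ a ℚ.+ (s ℚ.* t ℚ.+ t)                   ≡⟨ sym (ℚ.+-assoc (fromℤ a) (s ℚ.* t) t) ⟩
  fromℤ a ℚ.+ s ℚ.* t ℚ.+ t                     ≡⟨ sym (evalℚ-padd (a ∷ taylor p) (taylor p) s) ⟩
  evalℚ (taylor (a ∷ p)) s                      ∎
  where
  open ≡-Reasoning
  t = evalℚ (taylor p) s

*-mono-nonneg : ∀ {a b u v} → 0ℚ ℚ.≤ a → a ℚ.≤ b → 0ℚ ℚ.≤ u → u ℚ.≤ v → a ℚ.* u ℚ.≤ b ℚ.* v
*-mono-nonneg {a} {b} {u} {v} 0≤a a≤b 0≤u u≤v = ℚ.≤-trans
  (ℚ.*-monoˡ-≤-nonNeg a ⦃ ℚ.nonNegative 0≤a ⦄ u≤v) (ℚ.*-monoʳ-≤-nonNeg v ⦃ ℚ.nonNegative (ℚ.≤-trans 0≤u u≤v) ⦄ a≤b)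

evalℚ-nonneg : ∀ p → (∀ j → + 0 ≤ coef p j) → ∀ {s} → 0ℚ ℚ.≤ s → 0ℚ ℚ.≤ evalℚ p s
evalℚ-nonneg [] h 0≤s = ℚ.≤-refl
evalℚ-nonneg (a ∷ p) h {s} 0≤s = ℚ.≤-trans (ℚ.≤-reflexive (sym (ℚ.+-identityˡ 0ℚ))) (ℚ.+-mono-≤ (fromℤ-nonneg (h 0))
  (ℚ.≤-trans (ℚ.≤-reflexive (sym (ℚ.*-zeroˡ 0ℚ))) (*-mono-nonneg ℚ.≤-refl 0≤s ℚ.≤-refl (evalℚ-nonneg p (λ j → h (suc j)) 0≤s))))

evalℚ-mono : ∀ p → (∀ j → + 0 ≤ coef p j) → ∀ {s t} → 0ℚ ℚ.≤ s → s ℚ.≤ t → evalℚ p s ℚ.≤ evalℚ p t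
evalℚ-mono [] h 0≤s s≤t = ℚ.≤-refl
evalℚ-mono (a ∷ p) h 0≤s s≤t = ℚ.+-monoʳ-≤ (fromℤ a)
  (*-mono-nonneg 0≤s s≤t (evalℚ-nonneg p (λ j → h (suc j)) 0≤s) (evalℚ-mono p (λ j → h (suc j)) 0≤s s≤t))

evalℚ-positive : ∀ p → (∀ j → + 0 ≤ coef p j) → + 0 < coef p 0 → ∀ {s} → 0ℚ ℚ.≤ s → 0ℚ ℚ.< evalℚ p s
evalℚ-positive [] h (+<+ ()) 0≤s
evalℚ-positive (a ∷ p) h 0<a {s} 0≤s = ℚ.≤-<-trans (ℚ.≤-reflexive (sym (ℚ.+-identityˡ 0ℚ))) (ℚ.+-mono-<-≤ (fromℤ-positive 0<a)
  (ℚ.≤-trans (ℚ.≤-reflexive (sym (ℚ.*-zeroˡ 0ℚ))) (*-mono-nonneg ℚ.≤-refl 0≤s ℚ.≤-refl (evalℚ-nonneg p (λ j → h (suc j)) 0≤s))))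

-- For the tail p: s p(s) ≤ s p(t) < t p(t), the last since p(t) > 0. The constant term cancels, so
-- its sign is left free.
evalℚ-strict : ∀ p → (∀ j → + 0 ≤ coef p (suc j)) → + 0 < coef p 1 → ∀ {s t} → 0ℚ ℚ.≤ s → s ℚ.< t → evalℚ p s ℚ.< evalℚ p t
evalℚ-strict [] h (+<+ ()) 0≤s s<t
evalℚ-strict (a ∷ p) h pos {s} {t} 0≤s s<t = ℚ.+-monoʳ-< (fromℤ a) (ℚ.≤-<-trans
  (ℚ.*-monoˡ-≤-nonNeg s ⦃ ℚ.nonNegative 0≤s ⦄ (evalℚ-mono p h 0≤s s≤t))
  (ℚ.*-monoˡ-<-pos (evalℚ p t) ⦃ ℚ.positive (evalℚ-positive p h pos (ℚ.≤-trans 0≤s s≤t)) ⦄ s<t))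
  where
  s≤t = ℚ.<⇒≤ s<t

strictly-increasing : ∀ p → (∀ j → + 0 ≤ tcoef (suc j) p) → + 0 < tcoef 1 p →
  ∀ x y → 1ℚ ℚ.≤ x → x ℚ.< y → evalℚ p x ℚ.< evalℚ p y
strictly-increasing p h pos x y 1≤x x<y = subst₂ ℚ._<_ (at x) (at y)
  (evalℚ-strict (taylor p) (λ j → subst (+ 0 ≤_) (sym (coef-taylor p (suc j))) (h j))
    (subst (+ 0 <_) (sym (coef-taylor p 1)) pos)
    (subst (ℚ._≤ x ℚ.- 1ℚ) (ℚ.+-inverseʳ 1ℚ) (ℚ.+-monoˡ-≤ (ℚ.- 1ℚ) 1≤x)) (ℚ.+-monoˡ-< (ℚ.- 1ℚ) x<y))
  where
  at : ∀ x → evalℚ (taylor p) (x ℚ.- 1ℚ) ≡ evalℚ p x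
  at x = trans (sym (evalℚ-taylor p (x ℚ.- 1ℚ))) (cong (evalℚ p)
    (trans (cong (1ℚ ℚ.+_) (ℚ.+-comm x (ℚ.- 1ℚ))) (trans (sym (ℚ.+-assoc 1ℚ (ℚ.- 1ℚ) x)) (trans (cong (ℚ._+ x) (ℚ.+-inverseʳ 1ℚ)) (ℚ.+-identityˡ x)))))

-- The totient sum

count-yes : ∀ {P : Set} (P? : Dec P) → P → count P? ≡ 1
count-yes (yes _) p = refl
count-yes (no ¬p) p = ⊥-elim (¬p p)

count-no : ∀ {P : Set} (P? : Dec P) → ¬ P → count P? ≡ 0
count-no (yes p) ¬p = ⊥-elim (¬p p)
count-no (no _)  ¬p = refl

-- Σ₁ k f = f 1 + ⋯ + f k
Σ₁ : ℕ → (ℕ → ℕ) → ℕ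
Σ₁ zero f = 0
Σ₁ (suc k) f = Σ₁ k f ℕ.+ f (suc k)

Σ₁-cong : ∀ k {f g} → (∀ i → 1 ℕ.≤ i → i ℕ.≤ k → f i ≡ g i) → Σ₁ k f ≡ Σ₁ k g
Σ₁-cong zero h = refl
Σ₁-cong (suc k) h = cong₂ ℕ._+_ (Σ₁-cong k (λ i 1≤i i≤k → h i 1≤i (ℕ.m≤n⇒m≤1+n i≤k))) (h (suc k) (s≤s z≤n) ℕ.≤-refl)

Σ₁-zero : ∀ k {f} → (∀ i → 1 ℕ.≤ i → i ℕ.≤ k → f i ≡ 0) → Σ₁ k f ≡ 0
Σ₁-zero zero h = refl
Σ₁-zero (suc k) h = cong₂ ℕ._+_ (Σ₁-zero k (λ i 1≤i i≤k → h i 1≤i (ℕ.m≤n⇒m≤1+n i≤k))) (h (suc k) (s≤s z≤n) ℕ.≤-refl)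

Σ₁-one : ∀ k → Σ₁ k (λ _ → 1) ≡ k
Σ₁-one zero = refl
Σ₁-one (suc k) = trans (cong (ℕ._+ 1) (Σ₁-one k)) (ℕ.+-comm k 1)

Σ₁-+ : ∀ k f g → Σ₁ k (λ i → f i ℕ.+ g i) ≡ Σ₁ k f ℕ.+ Σ₁ k g
Σ₁-+ zero f g = refl
Σ₁-+ (suc k) f g rewrite Σ₁-+ k f g = lem (Σ₁ k f) (Σ₁ k g) (f (suc k)) (g (suc k))
  where
  lem : ∀ a b c d → a ℕ.+ b ℕ.+ (c ℕ.+ d) ≡ a ℕ.+ c ℕ.+ (b ℕ.+ d)
  lem = solveℕ-∀

Σ₁-swap : ∀ k l (f : ℕ → ℕ → ℕ) → Σ₁ k (λ i → Σ₁ l (f i)) ≡ Σ₁ l (λ j → Σ₁ k (λ i → f i j))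
Σ₁-swap zero l f = sym (Σ₁-zero l (λ _ _ _ → refl))
Σ₁-swap (suc k) l f = trans (cong (ℕ._+ Σ₁ l (f (suc k))) (Σ₁-swap k l f)) (sym (Σ₁-+ l _ (f (suc k))))

Σ₁-unique : ∀ k {f} d → 1 ℕ.≤ d → d ℕ.≤ k → f d ≡ 1 → (∀ i → i ≢ d → f i ≡ 0) → Σ₁ k f ≡ 1
Σ₁-unique zero d 1≤d d≤0 _ _ = ⊥-elim (ℕ.<⇒≱ 1≤d d≤0)
Σ₁-unique (suc k) {f} d 1≤d d≤k fd h with ℕ.m≤n⇒m<n∨m≡n d≤k
... | inj₁ d<k = cong₂ ℕ._+_ (Σ₁-unique k d 1≤d (ℕ.≤-pred d<k) fd h) (h (suc k) (λ eq → ℕ.<-irrefl (sym eq) d<k))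
... | inj₂ refl = cong₂ ℕ._+_ (Σ₁-zero k (λ i _ i≤k → h i (λ eq → ℕ.<-irrefl eq (s≤s i≤k)))) fd

Σ₁-append : ∀ k l f → Σ₁ (k ℕ.+ l) f ≡ Σ₁ k f ℕ.+ Σ₁ l (λ i → f (k ℕ.+ i))
Σ₁-append k zero f rewrite ℕ.+-identityʳ k = sym (ℕ.+-identityʳ _)
Σ₁-append k (suc l) f rewrite ℕ.+-suc k l | Σ₁-append k l f = ℕ.+-assoc (Σ₁ k f) _ _

-- In each block of e + 1 consecutive indices only the last can contribute.
Σ₁-multiples : ∀ d e f → (∀ i → ¬ suc e ∣ i → f i ≡ 0) → Σ₁ (d ℕ.* suc e) f ≡ Σ₁ d (λ j → f (j ℕ.* suc e))
Σ₁-multiples zero e f h = refl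
Σ₁-multiples (suc d) e f h = begin
  Σ₁ (suc e ℕ.+ d ℕ.* suc e) f                                   ≡⟨ cong (λ z → Σ₁ z f) (ℕ.+-comm (suc e) (d ℕ.* suc e)) ⟩
  Σ₁ (d ℕ.* suc e ℕ.+ suc e) f                                   ≡⟨ Σ₁-append (d ℕ.* suc e) (suc e) f ⟩
  Σ₁ (d ℕ.* suc e) f ℕ.+ (Σ₁ e (λ i → f (d ℕ.* suc e ℕ.+ i)) ℕ.+ f (d ℕ.* suc e ℕ.+ suc e))
    ≡⟨ cong₂ ℕ._+_ (Σ₁-multiples d e f h) (cong₂ ℕ._+_ (Σ₁-zero e between) (cong f (ℕ.+-comm (d ℕ.* suc e) (suc e)))) ⟩
  Σ₁ d (λ j → f (j ℕ.* suc e)) ℕ.+ f (suc d ℕ.* suc e)           ∎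
  where
  open ≡-Reasoning
  between : ∀ i → 1 ℕ.≤ i → i ℕ.≤ e → f (d ℕ.* suc e ℕ.+ i) ≡ 0
  between (suc i) _ i≤e = h _ (λ div → ℕ.<⇒≱ (s≤s i≤e) (ℕ.∣⇒≤ (ℕ.∣m+n∣m⇒∣n div (ℕ.n∣m*n d))))

Σ₁-filter : ∀ {P : ℕ → Set} (P? : ∀ i → Dec (P i)) (g : ℕ → ℕ) k →
  sum (map g (filter P? (map suc (upTo k)))) ≡ Σ₁ k (λ i → count (P? i) ℕ.* g i)
Σ₁-filter P? g zero = refl
Σ₁-filter P? g (suc k) = begin
  sum (map g (filter P? (map suc (upTo (suc k)))))
    ≡⟨ cong (λ l → sum (map g (filter P? l))) (trans (cong (map suc) (sym (List.upTo-∷ʳ k))) (List.map-++ suc (upTo k) (k ∷ []))) ⟩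
  sum (map g (filter P? (map suc (upTo k) ++ suc k ∷ [])))
    ≡⟨ cong (λ l → sum (map g l)) (List.filter-++ P? (map suc (upTo k)) (suc k ∷ [])) ⟩
  sum (map g (filter P? (map suc (upTo k)) ++ filter P? (suc k ∷ [])))
    ≡⟨ trans (cong sum (List.map-++ g (filter P? (map suc (upTo k))) _)) (sum-++ (map g (filter P? (map suc (upTo k)))) _) ⟩
  sum (map g (filter P? (map suc (upTo k)))) ℕ.+ sum (map g (filter P? (suc k ∷ [])))
    ≡⟨ cong₂ ℕ._+_ (Σ₁-filter P? g k) last ⟩
  Σ₁ k (λ i → count (P? i) ℕ.* g i) ℕ.+ count (P? (suc k)) ℕ.* g (suc k) ∎
  where
  open ≡-Reasoning
  last : sum (map g (filter P? (suc k ∷ []))) ≡ count (P? (suc k)) ℕ.* g (suc k)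
  last with P? (suc k)
  ... | yes _ = refl
  ... | no _  = refl

φ-Σ₁ : ∀ n → φ n ≡ Σ₁ n (λ d → count (coprime? d n))
φ-Σ₁ n = trans (length-sum (filter (λ d → coprime? d n) (map suc (upTo n)))) (trans (Σ₁-filter (λ d → coprime? d n) (λ _ → 1) n)
  (Σ₁-cong n (λ i _ _ → ℕ.*-identityʳ (count (coprime? i n)))))
  where
  length-sum : ∀ (l : List ℕ) → length l ≡ sum (map (λ _ → 1) l)
  length-sum [] = refl
  length-sum (_ ∷ l) = cong suc (length-sum l)

-- Each k ≤ n is counted at d = n / gcd k n.
totient-sum : ∀ n → Σ₁ (suc n) (λ d → count (d ∣? suc n) ℕ.* φ d) ≡ suc n
totient-sum n = begin
  Σ₁ N (λ d → count (d ∣? N) ℕ.* φ d)                      ≡⟨ Σ₁-cong N (λ d 1≤d _ → sym (column d 1≤d)) ⟩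
  Σ₁ N (λ d → Σ₁ N (λ k → count (gcd k N ℕ.* d ℕ.≟ N)))    ≡⟨ sym (Σ₁-swap N N (λ k d → count (gcd k N ℕ.* d ℕ.≟ N))) ⟩
  Σ₁ N (λ k → Σ₁ N (λ d → count (gcd k N ℕ.* d ℕ.≟ N)))    ≡⟨ Σ₁-cong N (λ k _ _ → row k) ⟩
  Σ₁ N (λ k → 1)                                           ≡⟨ Σ₁-one N ⟩
  N                                                        ∎
  where
  open ≡-Reasoning
  N = suc n
  row : ∀ k → Σ₁ N (λ d → count (gcd k N ℕ.* d ℕ.≟ N)) ≡ 1
  row k with gcd[m,n]∣n k N
  ... | divides (suc q) eq = Σ₁-unique N (suc q) (s≤s z≤n) (ℕ.∣⇒≤ (divides (gcd k N) (trans eq (ℕ.*-comm (suc q) (gcd k N)))))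
      (count-yes _ (trans (ℕ.*-comm (gcd k N) (suc q)) (sym eq)))
      (λ i i≢q → count-no _ (λ eq′ → i≢q (ℕ.*-cancelˡ-≡ i (suc q) (gcd k N) ⦃ ℕ.≢-nonZero (gcd[m,n]≢0 k N (inj₂ λ ())) ⦄
        (trans eq′ (trans eq (ℕ.*-comm (suc q) (gcd k N)))))))
  column : ∀ d → 1 ℕ.≤ d → Σ₁ N (λ k → count (gcd k N ℕ.* d ℕ.≟ N)) ≡ count (d ∣? N) ℕ.* φ d
  column d 1≤d with d ∣? N
  ... | no ¬d∣N = Σ₁-zero N (λ k _ _ → count-no _ (λ eq → ¬d∣N (divides (gcd k N) (sym eq))))
  -- With N = d (e + 1), the condition says gcd k N = e + 1; hence k = j (e + 1) with j ≤ d coprime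
  -- to d.
  ... | yes (divides (suc e) eq) = begin
      Σ₁ N (λ k → count (gcd k N ℕ.* d ℕ.≟ N))               ≡⟨ cong (λ z → Σ₁ z (λ k → count (gcd k N ℕ.* d ℕ.≟ N))) eq′ ⟩
      Σ₁ (d ℕ.* suc e) (λ k → count (gcd k N ℕ.* d ℕ.≟ N))   ≡⟨ Σ₁-multiples d e _ (λ i ∤ → count-no _ (λ g → ∤ (subst (_∣ i) (g≡ i g) (gcd[m,n]∣m i N)))) ⟩
      Σ₁ d (λ j → count (gcd (j ℕ.* suc e) N ℕ.* d ℕ.≟ N))   ≡⟨ Σ₁-cong d (λ j _ _ → count-cong _ _ (to j) (from j)) ⟩
      Σ₁ d (λ j → count (coprime? j d))                      ≡⟨ sym (φ-Σ₁ d) ⟩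
      φ d                                                    ≡⟨ sym (ℕ.*-identityˡ (φ d)) ⟩
      1 ℕ.* φ d                                              ∎
    where
    instance
      nz : ℕ.NonZero d
      nz = ℕ.>-nonZero 1≤d
    eq′ : N ≡ d ℕ.* suc e
    eq′ = trans eq (ℕ.*-comm (suc e) d)
    g≡ : ∀ i → gcd i N ℕ.* d ≡ N → gcd i N ≡ suc e
    g≡ i g = ℕ.*-cancelʳ-≡ (gcd i N) (suc e) d (trans g eq)
    scaled : ∀ j → gcd (j ℕ.* suc e) N ≡ suc e ℕ.* gcd j d
    scaled j = trans (cong₂ gcd (ℕ.*-comm j (suc e)) eq) (sym (c*gcd[m,n]≡gcd[cm,cn] (suc e) j d))
    to : ∀ j → gcd (j ℕ.* suc e) N ℕ.* d ≡ N → Coprime j d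
    to j g = gcd≡1⇒coprime (ℕ.*-cancelˡ-≡ (gcd j d) 1 (suc e) (trans (sym (scaled j)) (trans (g≡ (j ℕ.* suc e) g) (sym (ℕ.*-identityʳ (suc e))))))
    from : ∀ j → Coprime j d → gcd (j ℕ.* suc e) N ℕ.* d ≡ N
    from j co = trans (cong (ℕ._* d) (trans (scaled j) (trans (cong (suc e ℕ.*_) (coprime⇒gcd≡1 co)) (ℕ.*-identityʳ (suc e))))) (sym eq)

totient-sum-proper : ∀ n → φ (suc n) ℕ.+ sum (map φ (properDivisors (suc n))) ≡ suc n
totient-sum-proper n = begin
  φ (suc n) ℕ.+ sum (map φ (properDivisors (suc n)))                ≡⟨ ℕ.+-comm (φ (suc n)) _ ⟩
  sum (map φ (properDivisors (suc n))) ℕ.+ φ (suc n)                ≡⟨ cong₂ ℕ._+_ (Σ₁-filter (λ d → d ∣? suc n) φ n) top-term ⟩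
  Σ₁ (suc n) (λ d → count (d ∣? suc n) ℕ.* φ d)                     ≡⟨ totient-sum n ⟩
  suc n                                                             ∎
  where
  open ≡-Reasoning
  top-term : φ (suc n) ≡ count (suc n ∣? suc n) ℕ.* φ (suc n)
  top-term = trans (sym (ℕ.*-identityˡ _)) (cong (ℕ._* φ (suc n)) (sym (count-yes (suc n ∣? suc n) ℕ.∣-refl)))

-- Polynomial functions, divisibility and comaximality

-- Bézout coefficients are handled as functions, so that identities are checked pointwise by the
-- ring solver; the list is recalled only for cancellation and division.
IsPoly : (ℤ → ℤ) → Set
IsPoly f = ∃ λ p → ∀ x → evalℤ p x ≡ f x

poly-eval : ∀ p → IsPoly (evalℤ p)
poly-eval p = p , λ _ → refl

poly-const : ∀ c → IsPoly (λ _ → c)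
poly-const c = c ∷ [] , λ x → trans (cong (_+_ c) (ℤ.*-zeroʳ x)) (ℤ.+-identityʳ c)

poly-+ : ∀ {f g} → IsPoly f → IsPoly g → IsPoly (λ x → f x + g x)
poly-+ (p , hp) (q , hq) = padd p q , λ x → trans (eval-padd p q x) (cong₂ _+_ (hp x) (hq x))

poly-* : ∀ {f g} → IsPoly f → IsPoly g → IsPoly (λ x → f x * g x)
poly-* (p , hp) (q , hq) = pmul p q , λ x → trans (eval-pmul p q x) (cong₂ _*_ (hp x) (hq x))

poly-neg : ∀ {f} → IsPoly f → IsPoly (λ x → - f x)
poly-neg (p , hp) = scale (- + 1) p , λ x → trans (eval-scale (- + 1) p x) (trans (ℤ.-1*i≡-i (evalℤ p x)) (cong -_ (hp x)))

poly-^ : ∀ k → IsPoly (_^ k)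
poly-^ zero = poly-const (+ 1)
poly-^ (suc k) with poly-^ k
... | p , hp = + 0 ∷ p , λ x → trans (ℤ.+-identityˡ _) (cong (x *_) (hp x))

infix 4 _∣ᶠ_
_∣ᶠ_ : (ℤ → ℤ) → (ℤ → ℤ) → Set
f ∣ᶠ g = ∃ λ q → IsPoly q × ∀ x → g x ≡ f x * q x

∣ᶠ-refl : ∀ {f} → f ∣ᶠ f
∣ᶠ-refl {f} = (λ _ → + 1) , poly-const (+ 1) , λ x → sym (ℤ.*-identityʳ (f x))

∣ᶠ-trans : ∀ {f g h} → f ∣ᶠ g → g ∣ᶠ h → f ∣ᶠ h
∣ᶠ-trans {f} (q , pq , eq) (r , pr , er) = (λ x → q x * r x) , poly-* pq pr ,
  λ x → trans (er x) (trans (cong (_* r x) (eq x)) (ℤ.*-assoc (f x) (q x) (r x)))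

record Comaximal (f g : ℤ → ℤ) : Set where
  field
    c      : ℕ
    A B    : ℤ → ℤ
    poly-A : IsPoly A
    poly-B : IsPoly B
    bezout : ∀ x → A x * f x + B x * g x ≡ + suc c

comaximal-sym : ∀ {f g} → Comaximal f g → Comaximal g f
comaximal-sym {f} {g} C = record { c = c ; A = B ; B = A ; poly-A = poly-B ; poly-B = poly-A
  ; bezout = λ x → trans (ℤ.+-comm (B x * g x) (A x * f x)) (bezout x) }
  where open Comaximal C

comaximal-1 : ∀ {f g} → (∀ x → g x ≡ + 1) → Comaximal f g
comaximal-1 {f} {g} h = record { c = 0 ; A = λ _ → + 0 ; B = λ _ → + 1 ; poly-A = poly-const (+ 0) ; poly-B = poly-const (+ 1)
  ; bezout = λ x → trans (cong (λ z → + 0 * f x + + 1 * z) (h x)) (lem (f x)) }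
  where
  lem : ∀ u → + 0 * u + + 1 * + 1 ≡ + 1
  lem = solve-∀

-- Multiply the two Bézout identities: every term carries f except B B′ g h, and the constants
-- multiply.
comaximal-* : ∀ {f g h} → IsPoly f → IsPoly g → IsPoly h → Comaximal f g → Comaximal f h → Comaximal f (λ x → g x * h x)
comaximal-* {f} {g} {h} pf pg ph C D = record
  { c = D.c ℕ.+ C.c ℕ.* suc D.c
  ; A = λ x → C.A x * (D.A x * f x + D.B x * h x) + C.B x * g x * D.A x
  ; B = λ x → C.B x * D.B x
  ; poly-A = poly-+ (poly-* C.poly-A (poly-+ (poly-* D.poly-A pf) (poly-* D.poly-B ph))) (poly-* (poly-* C.poly-B pg) D.poly-A)
  ; poly-B = poly-* C.poly-B D.poly-B
  ; bezout = λ x → trans (lem (C.A x) (C.B x) (D.A x) (D.B x) (f x) (g x) (h x))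
      (trans (cong₂ _*_ (C.bezout x) (D.bezout x)) (sym (ℤ.pos-* (suc C.c) (suc D.c)))) }
  where
  module C = Comaximal C
  module D = Comaximal D
  lem : ∀ a b a′ b′ f g h → (a * (a′ * f + b′ * h) + b * g * a′) * f + b * b′ * (g * h) ≡ (a * f + b * g) * (a′ * f + b′ * h)
  lem = solve-∀

-- The polynomials x ^ n - 1

unity : ℕ → ℤ → ℤ
unity n x = x ^ n - + 1

poly-unity : ∀ n → IsPoly (unity n)
poly-unity n = poly-+ (poly-^ n) (poly-const (- + 1))

-- 1 + x^d + ⋯ + x^(d (k - 1)) in Horner form, the quotient of x^(k d) - 1 by x^d - 1.
geometric : ℕ → ℕ → ℤ → ℤ
geometric d zero x = + 0
geometric d (suc k) x = x ^ d * geometric d k x + + 1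

poly-geometric : ∀ d k → IsPoly (geometric d k)
poly-geometric d zero = poly-const (+ 0)
poly-geometric d (suc k) = poly-+ (poly-* (poly-^ d) (poly-geometric d k)) (poly-const (+ 1))

unity-multiple : ∀ d k x → unity (k ℕ.* d) x ≡ unity d x * geometric d k x
unity-multiple d zero x = sym (ℤ.*-zeroʳ (unity d x))
unity-multiple d (suc k) x = begin
  x ^ (d ℕ.+ k ℕ.* d) - + 1                          ≡⟨ cong (_- + 1) (ℤ.^-distribˡ-+-* x d (k ℕ.* d)) ⟩
  x ^ d * x ^ (k ℕ.* d) - + 1                        ≡⟨ lem (x ^ d) (x ^ (k ℕ.* d)) ⟩
  x ^ d * (x ^ (k ℕ.* d) - + 1) + (x ^ d - + 1)      ≡⟨ cong (λ z → x ^ d * z + (x ^ d - + 1)) (unity-multiple d k x) ⟩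
  x ^ d * ((x ^ d - + 1) * geometric d k x) + (x ^ d - + 1) ≡⟨ lem₂ (x ^ d) (geometric d k x) ⟩
  (x ^ d - + 1) * (x ^ d * geometric d k x + + 1)    ∎
  where
  open ≡-Reasoning
  lem : ∀ y z → y * z - + 1 ≡ y * (z - + 1) + (y - + 1)
  lem = solve-∀
  lem₂ : ∀ y g → y * ((y - + 1) * g) + (y - + 1) ≡ (y - + 1) * (y * g + + 1)
  lem₂ = solve-∀

unity-∣ᶠ : ∀ {d n} → d ∣ n → unity d ∣ᶠ unity n
unity-∣ᶠ {d} (divides k refl) = geometric d k , poly-geometric d k , unity-multiple d k

-- Each of the k terms is a power of x^d, hence 1 modulo x^d - 1.
geometric-mod : ∀ d k → ∃ λ t → IsPoly t × ∀ x → geometric d k x ≡ + k + unity d x * t x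
geometric-mod d zero = (λ _ → + 0) , poly-const (+ 0) , λ x → sym (trans (ℤ.+-identityˡ _) (ℤ.*-zeroʳ (unity d x)))
geometric-mod d (suc k) with geometric-mod d k
... | t , pt , h = (λ x → t x + geometric d k x) , poly-+ pt (poly-geometric d k) ,
    λ x → trans (lem₁ (x ^ d) (geometric d k x)) (trans (cong (λ z → z + + 1 + unity d x * geometric d k x) (h x))
      (lem₂ (+ k) (unity d x) (t x) (geometric d k x)))
  where
  lem₁ : ∀ y g → y * g + + 1 ≡ g + + 1 + (y - + 1) * g
  lem₁ = solve-∀
  lem₂ : ∀ k u t g → k + u * t + + 1 + u * g ≡ + 1 + k + u * (t + g)
  lem₂ = solve-∀

-- Subtracting x^g (x^(v e) - 1) from x^(u d) - 1 = x^(g + v e) - 1 leaves x^g - 1.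
unity-combination : ∀ d e {g} u v → g ℕ.+ v ℕ.* e ≡ u ℕ.* d → ∀ x →
  unity g x ≡ geometric d u x * unity d x + (- (x ^ g * geometric e v x)) * unity e x
unity-combination d e {g} u v eq x = begin
  x ^ g - + 1 ≡⟨ lem₁ (x ^ g) (x ^ (v ℕ.* e)) ⟩
  (x ^ g * x ^ (v ℕ.* e) - + 1) - x ^ g * (x ^ (v ℕ.* e) - + 1)
    ≡⟨ cong₂ (λ a b → (a - + 1) - x ^ g * b) (trans (sym (ℤ.^-distribˡ-+-* x g (v ℕ.* e))) (cong (x ^_) eq)) (unity-multiple e v x) ⟩
  unity (u ℕ.* d) x - x ^ g * (unity e x * geometric e v x)
    ≡⟨ cong (_- x ^ g * (unity e x * geometric e v x)) (unity-multiple d u x) ⟩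
  unity d x * geometric d u x - x ^ g * (unity e x * geometric e v x)
    ≡⟨ lem₂ (unity d x) (geometric d u x) (x ^ g) (unity e x) (geometric e v x) ⟩
  geometric d u x * unity d x + (- (x ^ g * geometric e v x)) * unity e x ∎
  where
  open ≡-Reasoning
  lem₁ : ∀ y z → y - + 1 ≡ (y * z - + 1) - y * (z - + 1)
  lem₁ = solve-∀
  lem₂ : ∀ a b y c g → a * b - y * (c * g) ≡ b * a + (- (y * g)) * c
  lem₂ = solve-∀

unity-gcd : ∀ d e → ∃ λ U → ∃ λ V → IsPoly U × IsPoly V × ∀ x → unity (gcd d e) x ≡ U x * unity d x + V x * unity e x
unity-gcd d e with Bézout.identity (gcd-GCD d e)
... | Bézout.+- u v eq = geometric d u , (λ x → - (x ^ gcd d e * geometric e v x)) , poly-geometric d u ,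
    poly-neg (poly-* (poly-^ (gcd d e)) (poly-geometric e v)) , unity-combination d e u v eq
... | Bézout.-+ u v eq = (λ x → - (x ^ gcd d e * geometric d u x)) , geometric e v ,
    poly-neg (poly-* (poly-^ (gcd d e)) (poly-geometric d u)) , poly-geometric e v , λ x → trans (unity-combination e d v u eq x) (ℤ.+-comm (geometric e v x * unity e x) _)


-- Π₁ k F = F 1 ⋯ F k
Π₁ : ℕ → (ℕ → ℤ → ℤ) → ℤ → ℤ
Π₁ zero F x = + 1
Π₁ (suc k) F x = F (suc k) x * Π₁ k F x

poly-Π₁ : ∀ k {F} → (∀ i → IsPoly (F i)) → IsPoly (Π₁ k F)
poly-Π₁ zero h = poly-const (+ 1)
poly-Π₁ (suc k) h = poly-* (h (suc k)) (poly-Π₁ k h)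

Π₁-∣ᶠ : ∀ k {F G} → (∀ i → F i ∣ᶠ G i) → Π₁ k F ∣ᶠ Π₁ k G
Π₁-∣ᶠ zero h = ∣ᶠ-refl
Π₁-∣ᶠ (suc k) {F} {G} h with h (suc k) | Π₁-∣ᶠ k {F} {G} h
... | q , pq , eq | r , pr , er = (λ x → q x * r x) , poly-* pq pr ,
    λ x → trans (cong₂ _*_ (eq x) (er x)) (lem (F (suc k) x) (q x) (Π₁ k F x) (r x))
  where
  lem : ∀ a b c d → a * b * (c * d) ≡ a * c * (b * d)
  lem = solve-∀

Π₁-extend : ∀ {k l F} → (∀ i → IsPoly (F i)) → k ℕ.≤ l → Π₁ k F ∣ᶠ Π₁ l F
Π₁-extend {l = zero} h z≤n = ∣ᶠ-refl
Π₁-extend {k} {suc l} {F} h k≤l with ℕ.m≤n⇒m<n∨m≡n k≤l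
... | inj₂ refl = ∣ᶠ-refl
... | inj₁ k<l = ∣ᶠ-trans {Π₁ k F} {Π₁ l F} (Π₁-extend h (ℕ.≤-pred k<l)) (F (suc l) , h (suc l) , λ x → ℤ.*-comm (F (suc l) x) _)

comaximal-Π₁ : ∀ k {f F} → IsPoly f → (∀ i → IsPoly (F i)) → (∀ i → 1 ℕ.≤ i → i ℕ.≤ k → Comaximal f (F i)) → Comaximal f (Π₁ k F)
comaximal-Π₁ zero pf pF h = comaximal-1 (λ _ → refl)
comaximal-Π₁ (suc k) pf pF h = comaximal-* pf (pF (suc k)) (poly-Π₁ k pF) (h (suc k) (s≤s z≤n) ℕ.≤-refl)
  (comaximal-Π₁ k pf pF (λ i 1≤i i≤k → h i 1≤i (ℕ.m≤n⇒m≤1+n i≤k)))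

-- Scale the Bézout identity A F + B Π of the new factor by c′ G, where Π divides c′ G: in the first
-- term replace c′ G by Π s, in the second replace G by F t. Each factor contributes its constant,
-- so only a multiple of G is reached.
product-divides : ∀ k {F G} → (∀ i → IsPoly (F i)) → IsPoly G →
  (∀ i j → 1 ℕ.≤ j → j ℕ.< i → i ℕ.≤ k → Comaximal (F i) (F j)) →
  (∀ i → 1 ℕ.≤ i → i ℕ.≤ k → F i ∣ᶠ G) →
  ∃ λ c → ∃ λ s → IsPoly s × ∀ x → + suc c * G x ≡ Π₁ k F x * s x
product-divides zero {F} {G} pF pG co div = 0 , G , pG , λ x → refl
product-divides (suc k) {F} {G} pF pG co div
  with div (suc k) (s≤s z≤n) ℕ.≤-refl
     | product-divides k {F} {G} pF pG (λ i j 1≤j j<i i≤k → co i j 1≤j j<i (ℕ.m≤n⇒m≤1+n i≤k)) (λ i 1≤i i≤k → div i 1≤i (ℕ.m≤n⇒m≤1+n i≤k))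
     | comaximal-Π₁ k {F (suc k)} {F} (pF (suc k)) pF (λ i 1≤i i≤k → co (suc k) i 1≤i (s≤s i≤k) ℕ.≤-refl)
... | t , pt , et | c′ , s , ps , es | C = c′ ℕ.+ c ℕ.* suc c′ , (λ x → A x * s x + + suc c′ * B x * t x) ,
    poly-+ (poly-* poly-A ps) (poly-* (poly-* (poly-const (+ suc c′)) poly-B) pt) , identity
  where
  open Comaximal C
  open ≡-Reasoning
  lem₁ : ∀ a f b p k g → (a * f + b * p) * k * g ≡ a * f * (k * g) + b * p * k * g
  lem₁ = solve-∀
  lem₂ : ∀ a f b p k s t → a * f * (p * s) + b * p * k * (f * t) ≡ f * p * (a * s + k * b * t)
  lem₂ = solve-∀
  identity : ∀ x → + suc (c′ ℕ.+ c ℕ.* suc c′) * G x ≡ Π₁ (suc k) F x * (A x * s x + + suc c′ * B x * t x)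
  identity x = begin
    + (suc c ℕ.* suc c′) * G x ≡⟨ cong (_* G x) (ℤ.pos-* (suc c) (suc c′)) ⟩
    + suc c * + suc c′ * G x ≡⟨ cong (λ z → z * + suc c′ * G x) (sym (bezout x)) ⟩
    (A x * F (suc k) x + B x * Π₁ k F x) * + suc c′ * G x
      ≡⟨ lem₁ (A x) (F (suc k) x) (B x) (Π₁ k F x) (+ suc c′) (G x) ⟩
    A x * F (suc k) x * (+ suc c′ * G x) + B x * Π₁ k F x * + suc c′ * G x
      ≡⟨ cong₂ (λ y z → A x * F (suc k) x * y + B x * Π₁ k F x * + suc c′ * z) (es x) (et x) ⟩
    A x * F (suc k) x * (Π₁ k F x * s x) + B x * Π₁ k F x * + suc c′ * (F (suc k) x * t x)
      ≡⟨ lem₂ (A x) (F (suc k) x) (B x) (Π₁ k F x) (+ suc c′) (s x) (t x) ⟩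
    F (suc k) x * Π₁ k F x * (A x * s x + + suc c′ * B x * t x) ∎

-- Cyclotomic polynomials

properDivisors-bounds : ∀ m → All (λ d → 1 ℕ.≤ d × d ℕ.≤ m) (properDivisors (suc m))
properDivisors-bounds m = All.filter⁺ (λ d → d ∣? suc m) (All.map⁺ (All.map (λ d<m → s≤s z≤n , d<m) (All.all-upTo m)))

-- `Φ n` passes fuel n - 1 to every proper divisor d, whereas `Φ d` starts with fuel d; the
-- recursion for `Φ` needs these to agree.
cycloF-fuel : ∀ f g n → 1 ℕ.≤ n → n ℕ.≤ f → n ℕ.≤ g → cycloF f n ≡ cycloF g n
cycloF-fuel zero g n 1≤n n≤f n≤g = ⊥-elim (ℕ.<⇒≱ 1≤n n≤f)
cycloF-fuel (suc f) zero n 1≤n n≤f n≤g = ⊥-elim (ℕ.<⇒≱ 1≤n n≤g)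
cycloF-fuel (suc f) (suc g) (suc m) 1≤n (s≤s m≤f) (s≤s m≤g) = cong (λ ps → pdiv (xnm1 (suc m)) (pprod ps))
  (List.map-cong-local (All.map (λ { (1≤d , d≤m) → cycloF-fuel f g _ 1≤d (ℕ.≤-trans d≤m m≤f) (ℕ.≤-trans d≤m m≤g) }) (properDivisors-bounds m)))

Φ-recursion : ∀ m → Φ (suc m) ≡ pdiv (xnm1 (suc m)) (pprod (map Φ (properDivisors (suc m))))
Φ-recursion m = cong (λ ps → pdiv (xnm1 (suc m)) (pprod ps))
  (List.map-cong-local (All.map (λ { (1≤d , d≤m) → cycloF-fuel m _ _ 1≤d d≤m ℕ.≤-refl }) (properDivisors-bounds m)))

-- Non-divisors contribute the factor 1, so products over divisors become products over an interval.
factor : ℕ → ℕ → Poly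
factor n i with i ∣? n
... | yes _ = Φ i
... | no _  = + 1 ∷ []

F : ℕ → ℕ → ℤ → ℤ
F n i = evalℤ (factor n i)

poly-F : ∀ n i → IsPoly (F n i)
poly-F n i = poly-eval (factor n i)

factor-divisor : ∀ {n i} → i ∣ n → factor n i ≡ Φ i
factor-divisor {n} {i} i∣n with i ∣? n
... | yes _ = refl
... | no ∤  = ⊥-elim (∤ i∣n)

eval-1 : ∀ x → evalℤ (+ 1 ∷ []) x ≡ + 1
eval-1 x = cong (_+_ (+ 1)) (ℤ.*-zeroʳ x)

eval-pprod-++ : ∀ ps qs x → evalℤ (pprod (ps ++ qs)) x ≡ evalℤ (pprod ps) x * evalℤ (pprod qs) x
eval-pprod-++ [] qs x = sym (trans (cong (_* evalℤ (pprod qs) x) (eval-1 x)) (ℤ.*-identityˡ _))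
eval-pprod-++ (p ∷ ps) qs x = begin
  evalℤ (pmul p (pprod (ps ++ qs))) x                       ≡⟨ eval-pmul p (pprod (ps ++ qs)) x ⟩
  evalℤ p x * evalℤ (pprod (ps ++ qs)) x                    ≡⟨ cong (evalℤ p x *_) (eval-pprod-++ ps qs x) ⟩
  evalℤ p x * (evalℤ (pprod ps) x * evalℤ (pprod qs) x)     ≡⟨ sym (ℤ.*-assoc (evalℤ p x) _ _) ⟩
  evalℤ p x * evalℤ (pprod ps) x * evalℤ (pprod qs) x       ≡⟨ cong (_* evalℤ (pprod qs) x) (sym (eval-pmul p (pprod ps) x)) ⟩
  evalℤ (pmul p (pprod ps)) x * evalℤ (pprod qs) x          ∎
  where open ≡-Reasoning

eval-pprod-Φ : ∀ n k x → evalℤ (pprod (map Φ (filter (λ d → d ∣? n) (map suc (upTo k))))) x ≡ Π₁ k (F n) x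
eval-pprod-Φ n zero x = eval-1 x
eval-pprod-Φ n (suc k) x = begin
  evalℤ (pprod (map Φ (filter ∣n? (map suc (upTo (suc k)))))) x
    ≡⟨ cong (λ l → evalℤ (pprod (map Φ (filter ∣n? l))) x) (trans (cong (map suc) (sym (List.upTo-∷ʳ k))) (List.map-++ suc (upTo k) (k ∷ []))) ⟩
  evalℤ (pprod (map Φ (filter ∣n? (map suc (upTo k) ++ suc k ∷ [])))) x
    ≡⟨ cong (λ l → evalℤ (pprod l) x) (trans (cong (map Φ) (List.filter-++ ∣n? (map suc (upTo k)) (suc k ∷ []))) (List.map-++ Φ (filter ∣n? (map suc (upTo k))) _)) ⟩
  evalℤ (pprod (map Φ (filter ∣n? (map suc (upTo k))) ++ map Φ (filter ∣n? (suc k ∷ [])))) x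
    ≡⟨ eval-pprod-++ (map Φ (filter ∣n? (map suc (upTo k)))) _ x ⟩
  evalℤ (pprod (map Φ (filter ∣n? (map suc (upTo k))))) x * evalℤ (pprod (map Φ (filter ∣n? (suc k ∷ [])))) x
    ≡⟨ cong₂ _*_ (eval-pprod-Φ n k x) last ⟩
  Π₁ k (F n) x * F n (suc k) x
    ≡⟨ ℤ.*-comm (Π₁ k (F n) x) _ ⟩
  F n (suc k) x * Π₁ k (F n) x ∎
  where
  open ≡-Reasoning
  ∣n? = λ d → d ∣? n
  last : evalℤ (pprod (map Φ (filter ∣n? (suc k ∷ [])))) x ≡ F n (suc k) x
  last with suc k ∣? n
  ... | yes d = trans (cong (λ l → evalℤ (pprod (map Φ l)) x) (List.filter-accept ∣n? d))
    (trans (eval-pmul (Φ (suc k)) (+ 1 ∷ []) x) (trans (cong (evalℤ (Φ (suc k)) x *_) (eval-1 x)) (ℤ.*-identityʳ _)))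
  ... | no ∤ = cong (λ l → evalℤ (pprod (map Φ l)) x) (List.filter-reject ∣n? ∤)

monic-pprod : ∀ l → All (λ d → Monic (φ d) (Φ d)) l → Monic (sum (map φ l)) (pprod (map Φ l))
monic-pprod [] [] = top
monic-pprod (d ∷ l) (m ∷ ms) = monic-pmul m (monic-pprod l ms)

record Cyclotomic (n : ℕ) : Set where
  field
    monic         : Monic (φ n) (Φ n)
    factorisation : ∀ x → evalℤ (Φ n) x * Π₁ (n ℕ.∸ 1) (F n) x ≡ unity n x

Φ-∣ᶠ-unity : ∀ {n} → Cyclotomic n → evalℤ (Φ n) ∣ᶠ unity n
Φ-∣ᶠ-unity {n} C = Π₁ (n ℕ.∸ 1) (F n) , poly-Π₁ (n ℕ.∸ 1) (poly-F n) , λ x → sym (Cyclotomic.factorisation C x)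

-- The divisors of g + 1 are all proper divisors of d, so x^(g + 1) - 1, the product of their
-- cyclotomic polynomials, divides the cofactor of Φ d in x^d - 1.
unity-∣ᶠ-proper : ∀ {g d} → Cyclotomic (suc g) → suc g ∣ d → suc g ℕ.≤ d ℕ.∸ 1 → unity (suc g) ∣ᶠ Π₁ (d ℕ.∸ 1) (F d)
unity-∣ᶠ-proper {g} {d} C g∣d g<d = ∣ᶠ-trans {unity (suc g)} {Π₁ (suc g) (F (suc g))} all
    (∣ᶠ-trans {Π₁ (suc g) (F (suc g))} {Π₁ (suc g) (F d)} (Π₁-∣ᶠ (suc g) {F (suc g)} {F d} factorwise) (Π₁-extend (poly-F d) g<d))
  where
  all : unity (suc g) ∣ᶠ Π₁ (suc g) (F (suc g))
  all = (λ _ → + 1) , poly-const (+ 1) , λ x → trans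
    (trans (cong (λ p → evalℤ p x * Π₁ g (F (suc g)) x) (factor-divisor (ℕ.∣-refl {suc g}))) (Cyclotomic.factorisation C x))
    (sym (ℤ.*-identityʳ _))
  factorwise : ∀ i → F (suc g) i ∣ᶠ F d i
  factorwise i with i ∣? suc g
  ... | yes i∣g rewrite factor-divisor (ℕ.∣-trans i∣g g∣d) = ∣ᶠ-refl
  ... | no _ = F d i , poly-F d i , λ x → sym (trans (cong (_* F d i x) (eval-1 x)) (ℤ.*-identityˡ _))

unity-cancel : ∀ g {a b} → IsPoly a → IsPoly b → (∀ x → unity (suc g) x * a x ≡ unity (suc g) x * b x) → ∀ x → a x ≡ b x
unity-cancel g (p , hp) (q , hq) h x = trans (sym (hp x)) (trans (monic-cancel-≈ p q (monic-xnm1 g)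
  (λ x → trans (cong₂ _*_ (eval-xnm1 g x) (hp x)) (trans (h x) (sym (cong₂ _*_ (eval-xnm1 g x) (hq x))))) x) (hq x))

-- With g = gcd d e, Φ d divides (x ^ d - 1) / (x ^ g - 1), which is d / g modulo x ^ g - 1,
-- and x ^ g - 1 is a combination of x ^ d - 1 and x ^ e - 1.
comaximal-gcd< : ∀ {d e g} → gcd d e ≡ suc g → suc g ℕ.< d → Cyclotomic (suc g) → Cyclotomic d → Cyclotomic e →
  Comaximal (evalℤ (Φ d)) (evalℤ (Φ e))
comaximal-gcd< {d} {e} {g} gcd≡ g<d Cg Cd Ce with subst (_∣ d) gcd≡ (gcd[m,n]∣m d e)
... | divides zero refl = ⊥-elim (ℕ.<⇒≱ g<d z≤n)
... | g∣d@(divides (suc q) d≡) with unity-∣ᶠ-proper Cg g∣d (ℕ.<⇒≤pred g<d) | geometric-mod (suc g) (suc q) | unity-gcd d e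
... | R , pR , eR | T , pT , eT | U , V , pU , pV , eUV = record
  { c = q
  ; A = λ x → R x - T x * (U x * hd x)
  ; B = λ x → - (T x * (V x * he x))
  ; poly-A = poly-+ pR (poly-neg (poly-* pT (poly-* pU (poly-Π₁ (d ℕ.∸ 1) (poly-F d)))))
  ; poly-B = poly-neg (poly-* pT (poly-* pV (poly-Π₁ (e ℕ.∸ 1) (poly-F e))))
  ; bezout = λ x → begin
      (R x - T x * (U x * hd x)) * Φd x + (- (T x * (V x * he x))) * Φe x
        ≡⟨ lem₁ (R x) (T x) (U x) (hd x) (Φd x) (V x) (he x) (Φe x) ⟩
      R x * Φd x - (U x * (Φd x * hd x) + V x * (Φe x * he x)) * T x
        ≡⟨ cong₂ (λ y z → R x * Φd x - (U x * y + V x * z) * T x) (Cyclotomic.factorisation Cd x) (Cyclotomic.factorisation Ce x) ⟩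
      R x * Φd x - (U x * unity d x + V x * unity e x) * T x
        ≡⟨ cong₂ (λ y z → y - z * T x) (quotient≡ x) (trans (sym (eUV x)) (cong (λ z → unity z x) gcd≡)) ⟩
      geometric (suc g) (suc q) x - unity (suc g) x * T x
        ≡⟨ cong (_- unity (suc g) x * T x) (eT x) ⟩
      + suc q + unity (suc g) x * T x - unity (suc g) x * T x
        ≡⟨ lem₂ (+ suc q) (unity (suc g) x * T x) ⟩
      + suc q ∎
  }
  where
  open ≡-Reasoning
  Φd = evalℤ (Φ d)
  Φe = evalℤ (Φ e)
  hd = Π₁ (d ℕ.∸ 1) (F d)
  he = Π₁ (e ℕ.∸ 1) (F e)
  lem₁ : ∀ r t u h p v h′ p′ → (r - t * (u * h)) * p + (- (t * (v * h′))) * p′ ≡ r * p - (u * (p * h) + v * (p′ * h′)) * t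
  lem₁ = solve-∀
  lem₂ : ∀ a b → a + b - b ≡ a
  lem₂ = solve-∀
  lem₃ : ∀ u r p → u * (r * p) ≡ p * (u * r)
  lem₃ = solve-∀
  quotient≡ : ∀ x → R x * Φd x ≡ geometric (suc g) (suc q) x
  quotient≡ = unity-cancel g (poly-* pR (poly-eval (Φ d))) (poly-geometric (suc g) (suc q)) λ x → begin
    unity (suc g) x * (R x * Φd x)   ≡⟨ lem₃ (unity (suc g) x) (R x) (Φd x) ⟩
    Φd x * (unity (suc g) x * R x)   ≡⟨ cong (Φd x *_) (sym (eR x)) ⟩
    Φd x * hd x                      ≡⟨ Cyclotomic.factorisation Cd x ⟩
    unity d x                        ≡⟨ cong (λ z → unity z x) d≡ ⟩
    unity (suc q ℕ.* suc g) x        ≡⟨ unity-multiple (suc g) (suc q) x ⟩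
    unity (suc g) x * geometric (suc g) (suc q) x ∎

comaximal-Φ : ∀ m → (∀ {d} → d ℕ.< suc m → 1 ℕ.≤ d → Cyclotomic d) → ∀ i j → 1 ℕ.≤ j → j ℕ.< i → i ℕ.≤ m →
  Comaximal (evalℤ (Φ i)) (evalℤ (Φ j))
comaximal-Φ m rec i j 1≤j j<i i≤m = by-gcd (gcd i j) refl
  where
  1≤i = ℕ.≤-trans 1≤j (ℕ.<⇒≤ j<i)
  i≢0 : i ≢ 0
  i≢0 refl = ℕ.<⇒≱ j<i z≤n
  j≤m = ℕ.≤-trans (ℕ.<⇒≤ j<i) i≤m
  by-gcd : ∀ g → gcd i j ≡ g → Comaximal (evalℤ (Φ i)) (evalℤ (Φ j))
  by-gcd zero eq = ⊥-elim (gcd[m,n]≢0 i j (inj₁ i≢0) eq)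
  by-gcd (suc g) eq = comaximal-gcd< eq g<i (rec (ℕ.<-≤-trans g<i (ℕ.m≤n⇒m≤1+n i≤m)) (s≤s z≤n)) (rec (s≤s i≤m) 1≤i) (rec (s≤s j≤m) 1≤j)
    where
    g<i : suc g ℕ.< i
    -- The gcd divides the smaller index j, hence is strictly below i; so i takes the role of d in
    -- `comaximal-gcd<`.
    g<i = ℕ.≤-<-trans (ℕ.∣⇒≤ ⦃ ℕ.>-nonZero 1≤j ⦄ (subst (_∣ j) eq (gcd[m,n]∣n i j))) j<i

-- By induction Q is monic of degree the sum of φ over the proper divisors, and Gauss' sum leaves
-- exactly φ n for the quotient. Pairwise comaximality makes Q divide a multiple of xⁿ - 1, so the
-- division is exact.
cyclotomic-step : ∀ m → (∀ {d} → d ℕ.< suc m → 1 ℕ.≤ d → Cyclotomic d) → Cyclotomic (suc m)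
cyclotomic-step m rec = record
  { monic = subst (Monic (φ (suc m))) (sym (Φ-recursion m)) (proj₁ exact)
  ; factorisation = λ x → trans (cong₂ _*_ (cong (λ p → evalℤ p x) (Φ-recursion m)) (sym (eval-pprod-Φ (suc m) m x)))
      (trans (proj₂ exact x) (eval-xnm1 m x)) }
  where
  n = suc m
  Q : Poly
  Q = pprod (map Φ (properDivisors n))
  coprime : ∀ i j → 1 ℕ.≤ j → j ℕ.< i → i ℕ.≤ m → Comaximal (F n i) (F n j)
  coprime i j 1≤j j<i i≤m with i ∣? n | j ∣? n
  ... | yes _ | yes _ = comaximal-Φ m rec i j 1≤j j<i i≤m
  ... | _     | no _  = comaximal-1 eval-1
  ... | no _  | yes _ = comaximal-sym (comaximal-1 eval-1)
  divisor : ∀ i → 1 ℕ.≤ i → i ℕ.≤ m → F n i ∣ᶠ unity n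
  divisor i 1≤i i≤m with i ∣? n
  ... | yes i∣n = ∣ᶠ-trans {evalℤ (Φ i)} {unity i} {unity n} (Φ-∣ᶠ-unity (rec (s≤s i≤m) 1≤i)) (unity-∣ᶠ i∣n)
  ... | no _ = unity n , poly-unity n , λ x → sym (trans (cong (_* unity n x) (eval-1 x)) (ℤ.*-identityˡ _))
  product : ∃ λ c → ∃ λ s → IsPoly s × ∀ x → + suc c * unity n x ≡ Π₁ m (F n) x * s x
  product = product-divides m (poly-F n) (poly-unity n) coprime divisor
  c = proj₁ product
  s = proj₁ (proj₁ (proj₂ (proj₂ product)))
  s≡ = proj₂ (proj₁ (proj₂ (proj₂ product)))
  identity = proj₂ (proj₂ (proj₂ product))
  exact : Monic (φ n) (pdiv (xnm1 n) Q) × (∀ x → evalℤ (pdiv (xnm1 n) Q) x * evalℤ Q x ≡ evalℤ (xnm1 n) x)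
  exact = pdiv-exact (φ n) c s
    (subst (λ k → Monic k (xnm1 n)) (sym (totient-sum-proper m)) (monic-xnm1 m))
    (monic-pprod (properDivisors n) (All.map (λ { (1≤d , d≤m) → Cyclotomic.monic (rec (s≤s d≤m) 1≤d) }) (properDivisors-bounds m)))
    (λ x → trans (cong (+ suc c *_) (eval-xnm1 m x)) (trans (identity x) (cong₂ _*_ (sym (eval-pprod-Φ n m x)) (sym (s≡ x)))))

cyclotomic : ∀ n → 1 ℕ.≤ n → Cyclotomic n
cyclotomic = <-rec _ λ { zero rec () ; (suc m) rec _ → cyclotomic-step m rec }

theorem1p1 : (n : ℕ) → 1 ℕ.≤ n →
    ((j : ℕ) → 1 ℕ.≤ j → j ℕ.≤ φ n → + 0 ℤ.< evalℤ (derivN j (Φ n)) (+ 1))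
    × ((k : ℕ) → k ℕ.< φ n → (x y : ℚ) → ℚ.1ℚ ℚ.≤ x → x ℚ.< y →
    evalℚ (derivN k (Φ n)) x ℚ.< evalℚ (derivN k (Φ n)) y)
theorem1p1 (suc m) 1≤n = derivatives , increasing
  where
  open Cyclotomic (cyclotomic (suc m) 1≤n)
  N = φ (suc m)
  f = Φ (suc m)
  cofactor : Monic (sum (map φ (properDivisors (suc m)))) (pprod (map Φ (properDivisors (suc m))))
  cofactor = monic-pprod (properDivisors (suc m))
    (All.map (λ { (1≤d , _) → Cyclotomic.monic (cyclotomic _ 1≤d) }) (properDivisors-bounds m))
  0<coefficient : ∀ j → suc j ℕ.≤ N → + 0 < tcoef (suc j) f
  0<coefficient = divisor-tcoef-positive monic cofactor (totient-sum-proper m) λ x →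
    trans (cong (evalℤ f x *_) (eval-pprod-Φ (suc m) m x)) (trans (factorisation x) (sym (eval-xnm1 m x)))
  -- Monotonicity asks for nonnegativity at every order; beyond the degree the coefficients are 0.
  -- Strictness is needed only at order k + 1, where k < φ n enters.
  0≤coefficient : ∀ j → + 0 ≤ tcoef (suc j) f
  0≤coefficient j with suc j ℕ.≤? N
  ... | yes j<N = ℤ.<⇒≤ (0<coefficient j j<N)
  ... | no j≮N = ℤ.≤-reflexive (sym (tcoef-high (suc j) f (subst (ℕ._≤ suc j) (sym (leading-length monic)) (ℕ.≰⇒> j≮N))))
  derivatives : (j : ℕ) → 1 ℕ.≤ j → j ℕ.≤ N → + 0 < evalℤ (derivN j f) (+ 1)
  derivatives (suc j) _ j<N = subst (+ 0 <_) (sym (evalℤ-1 (derivN (suc j) f)))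
    (derivN-positive (suc j) 0 f (subst (λ i → + 0 < tcoef i f) (sym (ℕ.+-identityʳ (suc j))) (0<coefficient j j<N)))
  increasing : (k : ℕ) → k ℕ.< N → (x y : ℚ) → 1ℚ ℚ.≤ x → x ℚ.< y → evalℚ (derivN k f) x ℚ.< evalℚ (derivN k f) y
  increasing k k<N = strictly-increasing (derivN k f)
    (λ j → derivN-nonneg k (suc j) f (subst (λ i → + 0 ≤ tcoef i f) (sym (ℕ.+-suc k j)) (0≤coefficient (k ℕ.+ j))))
    (derivN-positive k 1 f (subst (λ i → + 0 < tcoef i f) (ℕ.+-comm 1 k) (0<coefficient k k<N)))
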